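{- We have $$f(x;1,v,w)=\frac{x(1-v)[(1-x)^2-wx^2]-v^2wx(1-x)h(x;vw)}{(1-x)\bigl((1-v)[(1-x)^2-wx^2]-vwx\bigr)},$$ where $$h(x;t)=\sum_{0\le m<n}N_{n,m+1}x^nt^m=\frac{1-x-xt-\sqrt{(1-x-xt)^2-4x^2t}}{2xt},\qquad N_{n,k}=\tfrac1n\binom nk\binom n{k-1}.$$
   Context: An ascent sequence of length $n$ is a sequence $x_1\cdots x_n$ of non-negative integers with $x_1=0$ and $x_i\leq \mathrm{asc}(x_1\cdots x_{i-1})+1$ for $1<i\le n$, where $\mathrm{asc}$ counts indices $j$ with $x_j<x_{j+1}$. A sequence avoids $021$ if there are no indices $i<j<k$ with $\pi_i<\pi_k<\pi_j$. Define the generating function $f(x;1,v,w)=\sum_{n\ge1}\sum_{\pi}x^n v^{\max(\pi)}w^{\mathrm{asc}(\pi)}$, where the inner sum is over all $021$-avoiding ascent sequences $\pi$ of length $n$ and $\max(\pi)$ is the largest letter of $\pi$. -}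

module Defs where

open import Data.Bool using (Bool; true; false; _∧_; _∨_; not; if_then_else_)
open import Data.Nat using (ℕ; zero; suc; _∸_; _⊔_; _<ᵇ_; _≡ᵇ_; _/_)
  renaming (_+_ to _+ℕ_; _*_ to _*ℕ_)
open import Data.Nat.Combinatorics using (_C_)
open import Data.List using (List; []; _∷_; length; map; concatMap; upTo; foldr; take)
open import Data.Bool.ListAction using (any; all)
open import Data.Integer using (ℤ; +_; _+_; _*_; -_; _-_)

asc : List ℕ → ℕ
asc []            = 0
asc (x ∷ [])      = 0
asc (x ∷ y ∷ r)   = (if x <ᵇ y then 1 else 0) +ℕ asc (y ∷ r)

-- i-th entry (0-based); default 0 outside the range (never used there)
at : List ℕ → ℕ → ℕ
at []      _       = 0
at (x ∷ s) zero    = x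
at (x ∷ s) (suc i) = at s i

_≤ᵇ_ : ℕ → ℕ → Bool
m ≤ᵇ n = m <ᵇ suc n

isAscentSeq : List ℕ → Bool
isAscentSeq s = all check (upTo (length s))
  where
  check : ℕ → Bool
  check zero    = at s 0 ≡ᵇ 0
  check (suc i) = at s (suc i) ≤ᵇ (asc (take (suc i) s) +ℕ 1)

contains021 : List ℕ → Bool
contains021 s =
  any (λ k → any (λ j → any (λ i →
        (i <ᵇ j) ∧ (j <ᵇ k) ∧ (at s i <ᵇ at s k) ∧ (at s k <ᵇ at s j))
      (upTo (length s))) (upTo (length s))) (upTo (length s))

avoids021 : List ℕ → Bool
avoids021 s = not (contains021 s)

maxL : List ℕ → ℕ
maxL = foldr _⊔_ 0

words : ℕ → ℕ → List (List ℕ)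
words zero    m = [] ∷ []
words (suc n) m = concatMap (λ x → map (x ∷_) (words n m)) (upTo m)

countᵇ : {A : Set} → (A → Bool) → List A → ℕ
countᵇ p []      = 0
countᵇ p (x ∷ l) = (if p x then 1 else 0) +ℕ countᵇ p l

-- Every ascent sequence of length n has entries < n (x_i ≤ i-1), so
-- `words n n` contains all ascent sequences of length n.
-- fCoeff n a b = number of 021-avoiding ascent sequences π of length n ≥ 1
-- with max(π) = a and asc(π) = b  (coefficient of xⁿ vᵃ wᵇ in f(x;1,v,w)).
fCoeff : ℕ → ℕ → ℕ → ℕ
fCoeff zero    a b = 0
fCoeff (suc n) a b =
  countᵇ (λ s → isAscentSeq s ∧ avoids021 s ∧ (maxL s ≡ᵇ a) ∧ (asc s ≡ᵇ b))
         (words (suc n) (suc n))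

-- Formal power series in x, v, w with integer coefficients:
-- S n a b = coefficient of xⁿ vᵃ wᵇ.

Series : Set
Series = ℕ → ℕ → ℕ → ℤ

sumℤ : List ℤ → ℤ
sumℤ = foldr _+_ (+ 0)

infixl 6 _⊕_ _⊖_
infixl 7 _⊛_

_⊕_ : Series → Series → Series
(A ⊕ B) n a b = A n a b + B n a b

_⊖_ : Series → Series → Series
(A ⊖ B) n a b = A n a b - B n a b

_⊛_ : Series → Series → Series
(A ⊛ B) n a b =
  sumℤ (map (λ i → sumℤ (map (λ j → sumℤ (map (λ k →
      A i j k * B (n ∸ i) (a ∸ j) (b ∸ k))
    (upTo (suc b)))) (upTo (suc a)))) (upTo (suc n)))

mono : ℕ → ℕ → ℕ → Series
mono i j k n a b = if (n ≡ᵇ i) ∧ (a ≡ᵇ j) ∧ (b ≡ᵇ k) then + 1 else + 0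

𝟙 X V W : Series
𝟙 = mono 0 0 0
X = mono 1 0 0
V = mono 0 1 0
W = mono 0 0 1

F : Series
F n a b = + fCoeff n a b

narayana : ℕ → ℕ → ℕ
narayana zero    k = 0
narayana (suc n) k = ((suc n C k) *ℕ (suc n C (k ∸ 1))) / suc n

-- h(x; vw) = Σ_{0 ≤ m < n} N_{n,m+1} xⁿ (vw)ᵐ
H : Series
H n a b = if (a ≡ᵇ b) ∧ (a <ᵇ n) then + narayana n (suc a) else + 0

𝟘 : Series
𝟘 _ _ _ = + 0

-- A word beginning with 0 avoids 021 iff its nonzero letters increase weakly, so the admissible
-- continuations of a prefix depend only on whether its last letter is zero and on the slack
-- d = asc − max.  The generating functions of these continuations satisfy a linear system which
-- has a unique solution, since every further letter contributes a factor x.  Eliminating leaves a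
-- recurrence in d whose characteristic root is v(1 + th + th²), where t = vw and h is the power
-- series with h = x(1 + h)(1 + th); this makes the solution explicit in terms of h and bypasses
-- the kernel method.  That the Narayana series is h follows from the closed form for the
-- coefficients of its powers: by Pascal's rule these satisfy the linear recurrence
-- P (j+1) = x (P j + (1 + t) P (j+1) + t P (j+2)), whose solution is determined by P 0.
module Submission where

open import Defs
open import Algebra.Bundles using (CommutativeRing)
import Algebra.Solver.Ring as RingSolver
open import Algebra.Solver.Ring.AlmostCommutativeRing
  using (fromCommutativeRing; _-Raw-AlmostCommutative⟶_; Induced-equivalence)
open import Data.Bool using (Bool; true; false; _∧_; _∨_; not; if_then_else_; T)
open import Data.Bool.ListAction using (all)
open import Data.Bool.Properties using (T-∧; T-∨; ∧-zeroʳ)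
open import Data.Integer using (ℤ)
import Data.Integer as ℤ
import Data.Integer.Properties as ℤ
import Data.Integer.Solver as ℤ
open import Data.List using (List; []; _∷_; _++_; length; map; concatMap; upTo; applyUpTo; take)
open import Data.List.Properties using (map-upTo)
open import Data.List.Relation.Unary.Any.Properties using (any⁺; any⁻; applyUpTo⁺; applyUpTo⁻)
open import Data.Maybe using (just; nothing)
open import Data.Nat
  using (ℕ; zero; suc; _∸_; _⊔_; _<ᵇ_; _≡ᵇ_; _≤_; _<_; z≤n; s≤s; z<s; s<s; s<s⁻¹)
import Data.Nat as ℕ
open import Data.Nat.Combinatorics using (_C_; nCk+nC[k+1]≡[n+1]C[k+1])
import Data.Nat.DivMod as ℕ
import Data.Nat.Properties as ℕ
import Data.Nat.Solver as ℕ
open import Data.Product using (_×_; _,_; ∃; proj₁; proj₂)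
open import Data.Sum using (inj₂)
open import Data.Unit using (tt)
open import Function using (_∘_; id)
open import Function.Bundles using (Equivalence)
open import Level using (0ℓ)
open import Relation.Binary.Definitions using (WeaklyDecidable)
open import Relation.Nullary using (¬_; contradiction; yes; no)
open import Relation.Binary.PropositionalEquality
  using (_≡_; refl; sym; trans; cong; cong₂; subst; module ≡-Reasoning)

-- Power series over a commutative ring

module PowerSeries (R : CommutativeRing 0ℓ 0ℓ) where
  open CommutativeRing R renaming (Carrier to C; _+_ to _+ᴿ_; _*_ to _*ᴿ_; -_ to -ᴿ_)
    hiding (sym; trans; refl)
  open import Algebra.Properties.CommutativeSemigroup +-commutativeSemigroup
    using () renaming (interchange to +-interchange)
  private module E = CommutativeRing R
  open import Relation.Binary.Reasoning.Setoid setoid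

  PS : Set
  PS = ℕ → C

  infix 4 _≋_
  _≋_ : PS → PS → Set
  A ≋ B = ∀ n → A n ≈ B n

  one : PS
  one zero    = 1#
  one (suc n) = 0#

  -- The Cauchy product, by recursion that shifts the first factor; inductions on it need no
  -- truncated subtraction.
  conv : PS → PS → PS
  conv A B zero    = A 0 *ᴿ B 0
  conv A B (suc n) = (A 0 *ᴿ B (suc n)) +ᴿ conv (A ∘ suc) B n

  conv-cong : ∀ {A A′ B B′} → A ≋ A′ → B ≋ B′ → conv A B ≋ conv A′ B′
  conv-cong p q zero    = *-cong (p 0) (q 0)
  conv-cong p q (suc n) =
    +-cong (*-cong (p 0) (q (suc n))) (conv-cong (p ∘ suc) q n)

  conv-zeroˡ : ∀ {A} B → (∀ n → A n ≈ 0#) → ∀ n → conv A B n ≈ 0#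
  conv-zeroˡ B p zero    = E.trans (*-congʳ (p 0)) (zeroˡ _)
  conv-zeroˡ B p (suc n) = E.trans
    (+-cong (E.trans (*-congʳ (p 0)) (zeroˡ _)) (conv-zeroˡ B (p ∘ suc) n))
    (+-identityʳ 0#)

  conv-constˡ : ∀ A B → (∀ n → A (suc n) ≈ 0#) → ∀ n → conv A B n ≈ A 0 *ᴿ B n
  conv-constˡ A B p zero    = E.refl
  conv-constˡ A B p (suc n) = E.trans (+-congˡ (conv-zeroˡ B p n)) (+-identityʳ _)

  conv-identityˡ : ∀ B → conv one B ≋ B
  conv-identityˡ B n = E.trans (conv-constˡ one B (λ _ → E.refl) n) (*-identityˡ _)

  conv-varˡ : ∀ {A} B → A 0 ≈ 0# → A ∘ suc ≋ one → ∀ n → conv A B (suc n) ≈ B n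
  conv-varˡ B p q n = E.trans
    (+-cong (E.trans (*-congʳ p) (zeroˡ _))
            (E.trans (conv-cong q (λ _ → E.refl) n) (conv-identityˡ B n)))
    (+-identityˡ _)

  -- This splits off the last summand where the definition splits off the first; the two expansions
  -- together make commutativity an induction.
  conv-suc : ∀ A B n → conv A B (suc n) ≈ conv A (B ∘ suc) n +ᴿ (A (suc n) *ᴿ B 0)
  conv-suc A B zero    = E.refl
  conv-suc A B (suc n) =
    E.trans (+-congˡ (conv-suc (A ∘ suc) B n)) (E.sym (+-assoc _ _ _))

  conv-comm : ∀ A B → conv A B ≋ conv B A
  conv-comm A B zero    = *-comm _ _
  conv-comm A B (suc n) = begin
    (A 0 *ᴿ B (suc n)) +ᴿ conv (A ∘ suc) B n ≈⟨ +-cong (*-comm _ _) (conv-comm (A ∘ suc) B n) ⟩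
    (B (suc n) *ᴿ A 0) +ᴿ conv B (A ∘ suc) n ≈⟨ +-comm _ _ ⟩
    conv B (A ∘ suc) n +ᴿ (B (suc n) *ᴿ A 0) ≈⟨ conv-suc B A n ⟨
    conv B A (suc n)                         ∎

  conv-distribʳ : ∀ A B D n → conv (λ i → A i +ᴿ B i) D n ≈ conv A D n +ᴿ conv B D n
  conv-distribʳ A B D zero    = distribʳ _ _ _
  conv-distribʳ A B D (suc n) =
    E.trans (+-cong (distribʳ _ _ _) (conv-distribʳ (A ∘ suc) (B ∘ suc) D n))
            (+-interchange _ _ _ _)

  conv-scaleˡ : ∀ c A B n → conv (λ i → c *ᴿ A i) B n ≈ c *ᴿ conv A B n
  conv-scaleˡ c A B zero    = *-assoc _ _ _
  conv-scaleˡ c A B (suc n) =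
    E.trans (+-cong (*-assoc _ _ _) (conv-scaleˡ c (A ∘ suc) B n))
            (E.sym (distribˡ _ _ _))

  conv-assoc : ∀ A B D → conv (conv A B) D ≋ conv A (conv B D)
  conv-assoc A B D zero    = *-assoc _ _ _
  conv-assoc A B D (suc n) = begin
    ((A 0 *ᴿ B 0) *ᴿ D (suc n)) +ᴿ conv (conv A B ∘ suc) D n
      ≈⟨ +-cong (*-assoc _ _ _) (conv-distribʳ _ _ D n) ⟩
    (A 0 *ᴿ (B 0 *ᴿ D (suc n))) +ᴿ
      (conv (λ i → A 0 *ᴿ B (suc i)) D n +ᴿ conv (conv (A ∘ suc) B) D n)
      ≈⟨ +-assoc _ _ _ ⟨
    ((A 0 *ᴿ (B 0 *ᴿ D (suc n))) +ᴿ conv (λ i → A 0 *ᴿ B (suc i)) D n)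
      +ᴿ conv (conv (A ∘ suc) B) D n
      ≈⟨ +-cong (+-congˡ (conv-scaleˡ (A 0) (B ∘ suc) D n)) (conv-assoc (A ∘ suc) B D n) ⟩
    ((A 0 *ᴿ (B 0 *ᴿ D (suc n))) +ᴿ (A 0 *ᴿ conv (B ∘ suc) D n))
      +ᴿ conv (A ∘ suc) (conv B D) n
      ≈⟨ +-congʳ (distribˡ _ _ _) ⟨
    conv A (conv B D) (suc n) ∎

  powerSeriesRing : CommutativeRing 0ℓ 0ℓ
  powerSeriesRing = record
    { Carrier = PS
    ; _≈_     = _≋_
    ; _+_     = λ A B n → A n +ᴿ B n
    ; _*_     = conv
    ; -_      = λ A n → -ᴿ A n
    ; 0#      = λ _ → 0#
    ; 1#      = one
    ; isCommutativeRing = record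
      { isRing = record
        { +-isAbelianGroup = record
          { isGroup = record
            { isMonoid = record
              { isSemigroup = record
                { isMagma = record
                  { isEquivalence = record
                    { refl  = λ _ → E.refl
                    ; sym   = λ p n → E.sym (p n)
                    ; trans = λ p q n → E.trans (p n) (q n)
                    }
                  ; ∙-cong = λ p q n → +-cong (p n) (q n)
                  }
                ; assoc = λ A B D n → +-assoc _ _ _
                }
              ; identity = (λ A n → +-identityˡ _) , (λ A n → +-identityʳ _)
              }
            ; inverse = (λ A n → -‿inverseˡ _) , (λ A n → -‿inverseʳ _)
            ; ⁻¹-cong = λ p n → -‿cong (p n)
            }
          ; comm = λ A B n → +-comm _ _
          }
        ; *-cong     = conv-cong
        ; *-assoc    = conv-assoc
        ; *-identity = conv-identityˡ , λ A n → E.trans (conv-comm A one n) (conv-identityˡ A n)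
        ; distrib    =
            (λ A B D n → E.trans (conv-comm A _ n) (E.trans (conv-distribʳ B D A n)
                           (+-cong (conv-comm B A n) (conv-comm D A n))))
          , (λ A B D → conv-distribʳ B D A)
        }
      ; *-comm = conv-comm
      }
    }

  -- The additive map `e` reads off one integer coefficient, so the same lemma serves all three
  -- levels of nested convolution.
  conv-sumℤ : (e : C → ℤ) → (∀ x y → e (x +ᴿ y) ≡ e x ℤ.+ e y) → ∀ A B n →
              e (conv A B n) ≡ sumℤ (applyUpTo (λ i → e (A i *ᴿ B (n ∸ i))) (suc n))
  conv-sumℤ e e-+ A B zero    = sym (ℤ.+-identityʳ _)
  conv-sumℤ e e-+ A B (suc n) =
    trans (e-+ _ _) (cong (λ z → e (A 0 *ᴿ B (suc n)) ℤ.+ z) (conv-sumℤ e e-+ (A ∘ suc) B n))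

-- Polynomial identities

-- Over an arbitrary ring the solver never meets the coefficientwise sums and products of series;
-- `hom` supplies integer coefficients.
module RingIdentities (R : CommutativeRing 0ℓ 0ℓ)
  (hom : CommutativeRing.rawRing ℤ.+-*-commutativeRing -Raw-AlmostCommutative⟶ fromCommutativeRing R)
  where
  open CommutativeRing R hiding (refl; sym; trans)
  private module E = CommutativeRing R
  open _-Raw-AlmostCommutative⟶_ hom using (⟦_⟧)
  open import Relation.Binary.Reasoning.Setoid setoid

  hom-≟ : WeaklyDecidable (Induced-equivalence hom)
  hom-≟ c d with c ℤ.≟ d
  ... | yes refl = just E.refl
  ... | no  _      = nothing

  open RingSolver _ (fromCommutativeRing R) hom hom-≟
    using (Polynomial; solve; con; _:+_; _:*_; _:-_; :-_; _:=_)

  -- The solver reads the constant one as the image of + 1 rather than as 1#.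
  𝟏 : Carrier
  𝟏 = ⟦ ℤ.+ 1 ⟧

  𝟏ᴾ : ∀ {n} → Polynomial n
  𝟏ᴾ = con (ℤ.+ 1)

  -- Applied repeatedly, this reduces an identity modulo hypotheses y ≈ z to an explicit linear
  -- combination of them, which the solver can check.
  discard : ∀ {a b y z} c → y ≈ z → a ≈ b + c * (y - z) → a ≈ b
  discard {a} {b} {y} {z} c y≈z eq = begin
    a                ≈⟨ eq ⟩
    b + c * (y - z)  ≈⟨ +-congˡ (*-congˡ (+-congʳ y≈z)) ⟩
    b + c * (z - z)  ≈⟨ solve 3 (λ b c z → b :+ c :* (z :- z) := b) E.refl b c z ⟩
    b                ∎

  scale-powerStep : ∀ x t h a b c →
    h * (x * (a + b + t * b + t * c)) ≈ x * (h * a + h * b + t * (h * b) + t * (h * c))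
  scale-powerStep = solve 6 (λ x t h a b c →
    h :* (x :* (a :+ b :+ t :* b :+ t :* c))
      := x :* (h :* a :+ h :* b :+ t :* (h :* b) :+ t :* (h :* c))) E.refl

  expand-q : ∀ x t h → x * (𝟏 + h + t * h + t * (h * h)) ≈ x * (𝟏 + t * h * (𝟏 + h) + h)
  expand-q = solve 3 (λ x t h →
    x :* (𝟏ᴾ :+ h :+ t :* h :+ t :* (h :* h)) := x :* (𝟏ᴾ :+ t :* h :* (𝟏ᴾ :+ h) :+ h)) E.refl

  scale-A : ∀ k c x y a b s →
    k * (c + x * (b + a + y * s)) ≈ k * c + x * (k * b + k * a + y * (k * s))
  scale-A = solve 7 (λ k c x y a b s →
    k :* (c :+ x :* (b :+ a :+ y :* s)) := k :* c :+ x :* (k :* b :+ k :* a :+ y :* (k :* s))) E.refl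

  scale-B : ∀ k c x y b s → k * (c + x * (b + y * s)) ≈ k * c + x * (k * b + y * (k * s))
  scale-B = solve 6 (λ k c x y b s →
    k :* (c :+ x :* (b :+ y :* s)) := k :* c :+ x :* (k :* b :+ y :* (k :* s))) E.refl

  scale-S : ∀ k v a s → k * (a + v * s) ≈ k * a + v * (k * s)
  scale-S = solve 4 (λ k v a s → k :* (a :+ v :* s) := k :* a :+ v :* (k :* s)) E.refl

  -- With t = vw, `q` is 1 + th + th², so `h≈` is h = x(1 + h)(1 + th) multiplied out.
  module Kernel (x v w h q : Carrier) (h≈ : h ≈ x * (q + h)) (q≈ : q ≈ 𝟏 + v * w * h * (𝟏 + h)) where

    k : Carrier
    k = (𝟏 - v) * ((𝟏 - x) * (𝟏 - x) - w * x * x) - v * w * x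

    kᴾ : ∀ {n} → Polynomial n → Polynomial n → Polynomial n → Polynomial n
    kᴾ x v w = (𝟏ᴾ :- v) :* ((𝟏ᴾ :- x) :* (𝟏ᴾ :- x) :- w :* x :* x) :- v :* w :* x

    -- Eliminating B and S from a slack system gives a linear recurrence in d with characteristic
    -- root v q; the following is k times its solution, with r = (v q)ᵈ.
    solutionA solutionB solutionS : Carrier → Carrier
    solutionA r = 𝟏 - v - v * (q - 𝟏) * r
    solutionB r = (𝟏 - v) * (𝟏 - x + w * x) - w * v * h * (v * q * r)
    solutionS r = 𝟏 - v * q * r

    solution-A : ∀ r → solutionA r ≈ k + x * (solutionB r + solutionA r + w * v * solutionS r)
    solution-A r =
      -- The terms free of `r` cancel identically; those linear in `r` reduce to x q = (1 - x) h
      -- once `q≈` rewrites q - 1. The multipliers are the cofactors of the two relations.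
      discard (- (v * (𝟏 - x) * r)) q≈ (discard (- (v * w * v * (𝟏 + h) * r)) h≈
        (solve 6 (λ x v w h q r →
            𝟏ᴾ :- v :- v :* (q :- 𝟏ᴾ) :* r
            := kᴾ x v w :+ x :*
                 (((𝟏ᴾ :- v) :* (𝟏ᴾ :- x :+ w :* x) :- w :* v :* h :* (v :* q :* r))
                   :+ (𝟏ᴾ :- v :- v :* (q :- 𝟏ᴾ) :* r)
                   :+ w :* v :* (𝟏ᴾ :- v :* q :* r))
               :+ (:- (v :* (𝟏ᴾ :- x) :* r)) :* (q :- (𝟏ᴾ :+ v :* w :* h :* (𝟏ᴾ :+ h)))
               :+ (:- (v :* w :* v :* (𝟏ᴾ :+ h) :* r)) :* (h :- x :* (q :+ h)))
          E.refl x v w h q r))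

    solution-B : ∀ r → solutionB r ≈ k + x * (solutionB r + w * solutionS (v * q * r))
    solution-B r = discard (- (w * v * (v * q * r))) h≈
      (solve 6 (λ x v w h q s →
          (𝟏ᴾ :- v) :* (𝟏ᴾ :- x :+ w :* x) :- w :* v :* h :* s
          := kᴾ x v w :+ x :*
               (((𝟏ᴾ :- v) :* (𝟏ᴾ :- x :+ w :* x) :- w :* v :* h :* s)
                 :+ w :* (𝟏ᴾ :- v :* q :* s))
             :+ (:- (w :* v :* s)) :* (h :- x :* (q :+ h)))
        E.refl x v w h q (v * q * r))

    solution-S-zero : solutionS 𝟏 ≈ solutionA 𝟏
    solution-S-zero =
      solve 2 (λ v q → 𝟏ᴾ :- v :* q :* 𝟏ᴾ := 𝟏ᴾ :- v :- v :* (q :- 𝟏ᴾ) :* 𝟏ᴾ) E.refl v q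

    solution-S-suc : ∀ r → solutionS (v * q * r) ≈ solutionA (v * q * r) + v * solutionS r
    solution-S-suc = solve 3 (λ v q r →
        𝟏ᴾ :- v :* q :* (v :* q :* r)
        := (𝟏ᴾ :- v :- v :* (q :- 𝟏ᴾ) :* (v :* q :* r)) :+ v :* (𝟏ᴾ :- v :* q :* r))
      E.refl v q

    -- Here `a` stands for the continuations of a nonzero letter at slack 0, `e` for those of an
    -- all-zero prefix, and `g` for whole sequences. The result is back substitution.
    kernelEquation : ∀ {a e g} → k * a ≈ solutionA 𝟏 → e ≈ 𝟏 + x * (e + w * v * a) → g ≈ x * e →
      g * ((𝟏 - x) * k)
        ≈ x * (𝟏 - v) * ((𝟏 - x) * (𝟏 - x) - w * x * x) - v * v * w * x * (𝟏 - x) * h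
    kernelEquation {a} {e} {g} ka≈ e≈ g≈ =
      discard ((𝟏 - x) * k) g≈
      (discard (x * k) e≈
      (discard (x * x * w * v) ka≈
      -- What remains to be matched is - v²wx²q, and x q = (1 - x) h turns it into the term
      -- containing `h`.
      (discard (v * v * w * x) h≈
        (solve 8 (λ x v w h q a e g →
            g :* ((𝟏ᴾ :- x) :* kᴾ x v w)
            := x :* (𝟏ᴾ :- v) :* ((𝟏ᴾ :- x) :* (𝟏ᴾ :- x) :- w :* x :* x)
                 :- v :* v :* w :* x :* (𝟏ᴾ :- x) :* h
               :+ ((𝟏ᴾ :- x) :* kᴾ x v w) :* (g :- x :* e)
               :+ (x :* kᴾ x v w) :* (e :- (𝟏ᴾ :+ x :* (e :+ w :* v :* a)))
               :+ (x :* x :* w :* v) :* (kᴾ x v w :* a :- (𝟏ᴾ :- v :- v :* (q :- 𝟏ᴾ) :* 𝟏ᴾ))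
               :+ (v :* v :* w :* x) :* (h :- x :* (q :+ h)))
          E.refl x v w h q a e g))))

  -- The closed form with the radical is the solution formula of this quadratic, so no square root
  -- of a series has to be formed.
  quadratic : ∀ {x t h} → h ≈ x * (𝟏 + t * h * (𝟏 + h) + h) →
              x * t * h * h - (𝟏 - x - x * t) * h + x ≈ 0#
  quadratic {x} {t} {h} h≈ = discard (- 𝟏) h≈ (E.trans
    (solve 3 (λ x t h →
        x :* t :* h :* h :- (𝟏ᴾ :- x :- x :* t) :* h :+ x
        := (:- 𝟏ᴾ) :* (h :- x :* (𝟏ᴾ :+ t :* h :* (𝟏ᴾ :+ h) :+ h))) E.refl x t h)
    (E.sym (+-identityˡ _)))

-- Counting continuations

module Automaton where
  open import Data.Nat using (_+_)
  open import Data.Nat.Properties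

  -- The ascent condition and 021-avoidance as left-to-right scans

  rise : ℕ → ℕ → ℕ
  rise x y = if x <ᵇ y then 1 else 0

  -- The state of the scan is the last letter `ℓ` and the number `k` of ascents so far.
  ascentsBounded : ℕ → ℕ → List ℕ → Bool
  ascentsBounded ℓ k []      = true
  ascentsBounded ℓ k (y ∷ s) = (y ≤ᵇ (k + 1)) ∧ ascentsBounded y (k + rise ℓ y) s

  nonzerosIncrease : ℕ → List ℕ → Bool
  nonzerosIncrease m []      = true
  nonzerosIncrease m (y ∷ s) = ((y ≡ᵇ 0) ∨ (m ≤ᵇ y)) ∧ nonzerosIncrease (m ⊔ y) s

  T-≡ : ∀ {x y} → (T x → T y) → (T y → T x) → x ≡ y
  T-≡ {true}  {true}  _ _ = refl
  T-≡ {true}  {false} f _ with () ← f tt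
  T-≡ {false} {true}  _ g with () ← g tt
  T-≡ {false} {false} _ _ = refl

  isAscentSeq-∷ : ∀ x s → isAscentSeq (x ∷ s) ≡ (x ≡ᵇ 0) ∧ ascentsBounded x 0 s
  isAscentSeq-∷ x s = cong ((x ≡ᵇ 0) ∧_) (go x 0 s _ suc λ i → refl)
    where
    -- Generalised to a suffix: `g` enumerates its positions in the whole word, `ℓ` is the letter
    -- before it and `k` absorbs the earlier ascents.
    go : ∀ ℓ k s (f : ℕ → Bool) (g : ℕ → ℕ) →
         (∀ i → f (g i) ≡ at s i ≤ᵇ (k + asc (ℓ ∷ take i s) + 1)) →
         all f (applyUpTo g (length s)) ≡ ascentsBounded ℓ k s
    go ℓ k []      f g p = refl
    go ℓ k (y ∷ s) f g p = cong₂ _∧_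
      (trans (p 0) (cong (λ z → y ≤ᵇ (z + 1)) (+-identityʳ k)))
      (go y (k + rise ℓ y) s f (g ∘ suc) λ i → trans (p (suc i))
        (cong (λ z → at s i ≤ᵇ (z + 1)) (sym (+-assoc k (rise ℓ y) (asc (y ∷ take i s))))))

  Has021 : List ℕ → Set
  Has021 s = ∃ λ i → ∃ λ j → ∃ λ k → i < j × j < k × at s i < at s k × at s k < at s j

  -- Entries beyond the end default to 0, so a positive entry certifies its own index; this is why
  -- `Has021` carries no bounds.
  at-< : ∀ s k → 0 < at s k → k < length s
  at-< (x ∷ s) zero    _ = z<s
  at-< (x ∷ s) (suc k) p = s<s (at-< s k p)

  contains021-sound : ∀ s → T (contains021 s) → Has021 s
  contains021-sound s t
    with k , _ , t₁ ← applyUpTo⁻ id (any⁻ _ (upTo (length s)) t)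
    with j , _ , t₂ ← applyUpTo⁻ id (any⁻ _ (upTo (length s)) t₁)
    with i , _ , t₃ ← applyUpTo⁻ id (any⁻ _ (upTo (length s)) t₂)
    with i<j , t₄   ← Equivalence.to (T-∧ {i <ᵇ j}) t₃
    with j<k , t₅   ← Equivalence.to (T-∧ {j <ᵇ k}) t₄
    with p , q      ← Equivalence.to (T-∧ {at s i <ᵇ at s k}) t₅
    = i , j , k , <ᵇ⇒< i j i<j , <ᵇ⇒< j k j<k , <ᵇ⇒< _ _ p , <ᵇ⇒< _ _ q

  contains021-complete : ∀ s → Has021 s → T (contains021 s)
  contains021-complete s (i , j , k , i<j , j<k , p , q) =
    any⁺ _ (applyUpTo⁺ id (any⁺ _ (applyUpTo⁺ id (any⁺ _ (applyUpTo⁺ id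
      (Equivalence.from (T-∧ {i <ᵇ j}) (<⇒<ᵇ i<j ,
       Equivalence.from (T-∧ {j <ᵇ k}) (<⇒<ᵇ j<k ,
       Equivalence.from (T-∧ {at s i <ᵇ at s k}) (<⇒<ᵇ p , <⇒<ᵇ q))))
      (<-trans i<j j<n))) j<n)) k<n)
    where
    k<n = at-< s k (≤-<-trans z≤n p)
    j<n = <-trans j<k k<n

  -- The guards `0 < at s k` exempt both the zeros of the word and the default value beyond its end.
  Increasing : ℕ → List ℕ → Set
  Increasing m s = (∀ k → 0 < at s k → m ≤ at s k) ×
                   (∀ j k → j < k → 0 < at s k → at s j ≤ at s k)

  ≤ᵇ-sound : ∀ {m n} → T (m ≤ᵇ n) → m ≤ n
  ≤ᵇ-sound {m} {n} t = ≤-pred (<ᵇ⇒< m (suc n) t)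

  ≤ᵇ-complete : ∀ {m n} → m ≤ n → T (m ≤ᵇ n)
  ≤ᵇ-complete m≤n = <⇒<ᵇ (s≤s m≤n)

  nonzerosIncrease-sound : ∀ m s → T (nonzerosIncrease m s) → Increasing m s
  nonzerosIncrease-sound m []      _ = (λ _ ()) , λ _ _ _ ()
  nonzerosIncrease-sound m (y ∷ s) t
    with t₁ , t₂       ← Equivalence.to (T-∧ {(y ≡ᵇ 0) ∨ (m ≤ᵇ y)}) t
    with above , pairs ← nonzerosIncrease-sound (m ⊔ y) s t₂
    = above′ , pairs′
    where
    head : ∀ y → T ((y ≡ᵇ 0) ∨ (m ≤ᵇ y)) → 0 < y → m ≤ y
    head (suc y) t _ = ≤ᵇ-sound t
    above′ : ∀ k → 0 < at (y ∷ s) k → m ≤ at (y ∷ s) k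
    above′ zero    p = head y t₁ p
    above′ (suc k) p = ≤-trans (m≤m⊔n m y) (above k p)
    pairs′ : ∀ j k → j < k → 0 < at (y ∷ s) k → at (y ∷ s) j ≤ at (y ∷ s) k
    pairs′ zero    (suc k) _   p = ≤-trans (m≤n⊔m m y) (above k p)
    pairs′ (suc j) (suc k) j<k p = pairs j k (s<s⁻¹ j<k) p

  nonzerosIncrease-complete : ∀ m s → Increasing m s → T (nonzerosIncrease m s)
  nonzerosIncrease-complete m []      _               = tt
  nonzerosIncrease-complete m (y ∷ s) (above , pairs) =
    Equivalence.from (T-∧ {(y ≡ᵇ 0) ∨ (m ≤ᵇ y)})
      ( head y (above 0)
      , nonzerosIncrease-complete (m ⊔ y) s
          ( (λ k p → ⊔-lub (above (suc k) p) (pairs 0 (suc k) z<s p))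
          , λ j k j<k → pairs (suc j) (suc k) (s<s j<k)))
    where
    head : ∀ y → (0 < y → m ≤ y) → T ((y ≡ᵇ 0) ∨ (m ≤ᵇ y))
    head zero    _ = tt
    head (suc y) p = ≤ᵇ-complete (p z<s)

  -- The initial zero plays the role of the 0 in the pattern 021.
  avoids021-∷ : ∀ s → avoids021 (0 ∷ s) ≡ nonzerosIncrease 0 s
  avoids021-∷ s = T-≡
    (λ t → nonzerosIncrease-complete 0 s ((λ _ _ → z≤n) , λ j k j<k p →
      ≮⇒≥ λ q → T-not t (contains021-complete (0 ∷ s)
        (0 , suc j , suc k , z<s , s<s j<k , p , q))))
    (λ t → not-T λ c → absurd t (contains021-sound (0 ∷ s) c))
    where
    T-not : ∀ {x} → T (not x) → ¬ T x
    T-not {false} _ ()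
    not-T : ∀ {x} → ¬ T x → T (not x)
    not-T {true}  ¬t = contradiction tt ¬t
    not-T {false} _  = tt
    absurd : T (nonzerosIncrease 0 s) → ¬ Has021 (0 ∷ s)
    absurd t (i , suc j , suc k , _ , j<k , p , q) =
      <⇒≱ q (proj₂ (nonzerosIncrease-sound 0 s t) j k (s<s⁻¹ j<k) (≤-<-trans z≤n p))

  Target : Set
  Target = ℕ → ℕ → Bool

  -- Scans a word with last letter ℓ, maximum m and k ascents read so far;
  -- τ tests the final maximum and number of ascents.
  accepts : ℕ → ℕ → ℕ → Target → List ℕ → Bool
  accepts ℓ m k τ []      = τ m k
  accepts ℓ m k τ (y ∷ s) =
    ((y ≤ᵇ (k + 1)) ∧ ((y ≡ᵇ 0) ∨ (m ≤ᵇ y))) ∧ accepts y (m ⊔ y) (k + rise ℓ y) τ s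

  accepts-correct : ∀ ℓ m k τ s → accepts ℓ m k τ s
    ≡ ascentsBounded ℓ k s ∧ nonzerosIncrease m s ∧ τ (m ⊔ maxL s) (k + asc (ℓ ∷ s))
  accepts-correct ℓ m k τ []      = cong₂ τ (sym (⊔-identityʳ m)) (sym (+-identityʳ k))
  accepts-correct ℓ m k τ (y ∷ s) = begin
    (p ∧ q) ∧ accepts y (m ⊔ y) (k + rise ℓ y) τ s
      ≡⟨ cong ((p ∧ q) ∧_) (accepts-correct y (m ⊔ y) (k + rise ℓ y) τ s) ⟩
    (p ∧ q) ∧ (p′ ∧ q′ ∧ τ (m ⊔ y ⊔ maxL s) (k + rise ℓ y + asc (y ∷ s)))
      ≡⟨ cong₂ (λ a b → (p ∧ q) ∧ (p′ ∧ q′ ∧ τ a b)) (⊔-assoc m y (maxL s))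
           (+-assoc k (rise ℓ y) (asc (y ∷ s))) ⟩
    (p ∧ q) ∧ (p′ ∧ q′ ∧ r)
      ≡⟨ rearrange p q p′ ⟩
    (p ∧ p′) ∧ ((q ∧ q′) ∧ r) ∎
    where
    open ≡-Reasoning
    p  = y ≤ᵇ (k + 1)
    q  = (y ≡ᵇ 0) ∨ (m ≤ᵇ y)
    p′ = ascentsBounded y (k + rise ℓ y) s
    q′ = nonzerosIncrease (m ⊔ y) s
    r  = τ (m ⊔ maxL (y ∷ s)) (k + asc (ℓ ∷ y ∷ s))
    rearrange : ∀ p q p′ {q′ r} → (p ∧ q) ∧ (p′ ∧ q′ ∧ r) ≡ (p ∧ p′) ∧ ((q ∧ q′) ∧ r)
    rearrange true  true  p′    = refl
    rearrange true  false true  = refl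
    rearrange true  false false = refl
    rearrange false q     p′    = refl

  -- Counting words letter by letter

  sumTo : ℕ → (ℕ → ℕ) → ℕ
  sumTo zero    g = 0
  sumTo (suc n) g = g 0 + sumTo n (g ∘ suc)

  sumTo-zero : ∀ n {g} → (∀ i → g i ≡ 0) → sumTo n g ≡ 0
  sumTo-zero zero    p = refl
  sumTo-zero (suc n) p = cong₂ _+_ (p 0) (sumTo-zero n (p ∘ suc))

  sumTo-drop : ∀ m {n g} → (∀ i → i < m → g i ≡ 0) → sumTo (m + n) g ≡ sumTo n (λ i → g (m + i))
  sumTo-drop zero    p = refl
  sumTo-drop (suc m) {n} {g} p =
    cong₂ _+_ (p 0 z<s) (sumTo-drop m {n} {g ∘ suc} (λ i i<m → p (suc i) (s<s i<m)))

  countᵇ-++ : ∀ {A : Set} (p : A → Bool) xs ys → countᵇ p (xs ++ ys) ≡ countᵇ p xs + countᵇ p ys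
  countᵇ-++ p []       ys = refl
  countᵇ-++ p (x ∷ xs) ys = trans (cong (head +_) (countᵇ-++ p xs ys)) (sym (+-assoc head (countᵇ p xs) (countᵇ p ys)))
    where head = if p x then 1 else 0

  countᵇ-map : ∀ {A B : Set} (p : B → Bool) (f : A → B) xs → countᵇ p (map f xs) ≡ countᵇ (p ∘ f) xs
  countᵇ-map p f []       = refl
  countᵇ-map p f (x ∷ xs) = cong (_ +_) (countᵇ-map p f xs)

  countᵇ-cong : ∀ {A : Set} {p q : A → Bool} → (∀ x → p x ≡ q x) → ∀ xs → countᵇ p xs ≡ countᵇ q xs
  countᵇ-cong e []       = refl
  countᵇ-cong e (x ∷ xs) = cong₂ (λ b n → (if b then 1 else 0) + n) (e x) (countᵇ-cong e xs)

  countᵇ-none : ∀ {A : Set} {p : A → Bool} → (∀ x → p x ≡ false) → ∀ xs → countᵇ p xs ≡ 0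
  countᵇ-none e []       = refl
  countᵇ-none e (x ∷ xs) = cong₂ (λ b n → (if b then 1 else 0) + n) (e x) (countᵇ-none e xs)

  countᵇ-words : ∀ p n M → countᵇ p (words (suc n) M) ≡ sumTo M (λ y → countᵇ (p ∘ (y ∷_)) (words n M))
  countᵇ-words p n M = go id M
    where
    go : ∀ h N → countᵇ p (concatMap (λ y → map (y ∷_) (words n M)) (applyUpTo h N))
               ≡ sumTo N (λ i → countᵇ (p ∘ (h i ∷_)) (words n M))
    go h zero    = refl
    go h (suc N) = trans (countᵇ-++ p (map (h 0 ∷_) (words n M)) _)
      (cong₂ _+_ (countᵇ-map p (h 0 ∷_) (words n M)) (go (h ∘ suc) N))

  -- A letter raising the maximum by i uses up i units of slack. On generating functions this is the
  -- sum of vⁱ times the series for slack d - i, over 0 ≤ i ≤ d.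
  shifts : (ℕ → Target → ℕ) → ℕ → Target → ℕ
  shifts f zero    τ = f 0 τ
  shifts f (suc d) τ = f (suc d) τ + shifts f d (λ i j → τ (suc i) j)

  -- Continuations by n letters of a prefix with slack d = asc − max whose last letter is
  -- nonzero, respectively zero; τ tests the increments of the maximum and of asc.
  afterNonzero afterZero : ℕ → ℕ → Target → ℕ
  afterNonzero zero    d τ = if τ 0 0 then 1 else 0
  afterNonzero (suc n) d τ =
    afterZero n d τ + afterNonzero n d τ + shifts (afterNonzero n) d (λ i j → τ (suc i) (suc j))
  afterZero zero    d τ = if τ 0 0 then 1 else 0
  afterZero (suc n) d τ = afterZero n d τ + shifts (afterNonzero n) (suc d) (λ i j → τ i (suc j))

  -- An all-zero prefix is kept apart because its maximum is the letter 0 itself: the only possible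
  -- ascent is to 1 and leaves slack 0, whereas `afterZero` presupposes a positive maximum that can
  -- recur as an ascent.
  afterZeros : ℕ → Target → ℕ
  afterZeros zero    τ = if τ 0 0 then 1 else 0
  afterZeros (suc n) τ = afterZeros n τ + afterNonzero n 0 (λ i j → τ (suc i) (suc j))

  infix 4 _≐_
  _≐_ : Target → Target → Set
  σ ≐ τ = ∀ i j → σ i j ≡ τ i j

  module _ {f : ℕ → Target → ℕ} where
    shifts-cong : (∀ d {σ τ} → σ ≐ τ → f d σ ≡ f d τ) → ∀ d {σ τ} → σ ≐ τ → shifts f d σ ≡ shifts f d τ
    shifts-cong f-cong zero    p = f-cong 0 p
    shifts-cong f-cong (suc d) p = cong₂ _+_ (f-cong (suc d) p) (shifts-cong f-cong d (λ i → p (suc i)))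

    shifts-none : (∀ d {τ} → (∀ i j → τ i j ≡ false) → f d τ ≡ 0) →
                  ∀ d {τ} → (∀ i j → τ i j ≡ false) → shifts f d τ ≡ 0
    shifts-none f-none zero    p = f-none 0 p
    shifts-none f-none (suc d) p = cong₂ _+_ (f-none (suc d) p) (shifts-none f-none d (λ i → p (suc i)))

    -- The equation `i + c ≡ e` splits the available slack into the part used by the letter and the
    -- part left over; letters beyond `e` violate the ascent bound.
    sumTo-shifts : ∀ e N g τ → (∀ i c → i + c ≡ e → g i ≡ f c (λ a b → τ (i + a) b)) →
                   (∀ i → e < i → g i ≡ 0) → e < N → sumTo N g ≡ shifts f e τ
    sumTo-shifts zero    (suc N) g τ p z _   =
      trans (cong₂ _+_ (p 0 0 refl) (sumTo-zero N (λ i → z (suc i) z<s))) (+-identityʳ _)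
    sumTo-shifts (suc e) (suc N) g τ p z e<N = cong₂ _+_ (p 0 (suc e) refl)
      (sumTo-shifts e N (g ∘ suc) (λ i j → τ (suc i) j)
        (λ i c eq → p (suc i) c (cong suc eq)) (λ i lt → z (suc i) (s<s lt)) (s<s⁻¹ e<N))

  afterNonzero-cong : ∀ n d {σ τ} → σ ≐ τ → afterNonzero n d σ ≡ afterNonzero n d τ
  afterZero-cong    : ∀ n d {σ τ} → σ ≐ τ → afterZero n d σ ≡ afterZero n d τ
  afterNonzero-cong zero    d p = cong (if_then 1 else 0) (p 0 0)
  afterNonzero-cong (suc n) d p = cong₂ _+_
    (cong₂ _+_ (afterZero-cong n d p) (afterNonzero-cong n d p))
    (shifts-cong (afterNonzero-cong n) d (λ i j → p (suc i) (suc j)))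
  afterZero-cong zero    d p = cong (if_then 1 else 0) (p 0 0)
  afterZero-cong (suc n) d p = cong₂ _+_ (afterZero-cong n d p)
    (shifts-cong (afterNonzero-cong n) (suc d) (λ i j → p i (suc j)))

  -- An indicator of exponent 0 becomes constantly false when shifted; this gives the vanishing
  -- lowest coefficients of a multiple of v or w.
  afterNonzero-none : ∀ n d {τ} → (∀ i j → τ i j ≡ false) → afterNonzero n d τ ≡ 0
  afterZero-none    : ∀ n d {τ} → (∀ i j → τ i j ≡ false) → afterZero n d τ ≡ 0
  afterNonzero-none zero    d p = cong (if_then 1 else 0) (p 0 0)
  afterNonzero-none (suc n) d p = cong₂ _+_
    (cong₂ _+_ (afterZero-none n d p) (afterNonzero-none n d p))
    (shifts-none (afterNonzero-none n) d (λ i j → p (suc i) (suc j)))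
  afterZero-none zero    d p = cong (if_then 1 else 0) (p 0 0)
  afterZero-none (suc n) d p = cong₂ _+_ (afterZero-none n d p)
    (shifts-none (afterNonzero-none n) (suc d) (λ i j → p i (suc j)))

  -- The lemmas classify the next letter: zero, nonzero but below the maximum, above the ascent
  -- bound, or admissible, in which case it becomes the new maximum.
  module Letter (ℓ m k : ℕ) (τ : Target) (n M : ℕ) where

    letter : ℕ → ℕ
    letter y = countᵇ (accepts ℓ m k τ ∘ (y ∷_)) (words n M)

    letter-zero : letter 0 ≡ countᵇ (accepts 0 m k τ) (words n M)
    letter-zero = cong₂ (λ m′ k′ → countᵇ (accepts 0 m′ k′ τ) (words n M))
      (⊔-identityʳ m) (+-identityʳ k)

    T→≡ : ∀ {x} → T x → x ≡ true
    T→≡ {true} _ = refl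

    ¬T→≡ : ∀ {x} → ¬ T x → x ≡ false
    ¬T→≡ {true}  ¬t = contradiction tt ¬t
    ¬T→≡ {false} _  = refl

    letter-small : ∀ y → 0 < y → y < m → letter y ≡ 0
    letter-small (suc y) _ y<m = countᵇ-none
      (λ s → cong (_∧ accepts (suc y) (m ⊔ suc y) (k + rise ℓ (suc y)) τ s)
        (trans (cong ((suc y ≤ᵇ (k + 1)) ∧_) (¬T→≡ λ t → <⇒≱ y<m (≤ᵇ-sound t))) (∧-zeroʳ _)))
      (words n M)

    letter-large : ∀ y → k + 1 < y → letter y ≡ 0
    letter-large y k+1<y = countᵇ-none
      (λ s → cong (λ z → (z ∧ ((y ≡ᵇ 0) ∨ (m ≤ᵇ y))) ∧ accepts y (m ⊔ y) (k + rise ℓ y) τ s)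
        (¬T→≡ λ t → <⇒≱ k+1<y (≤ᵇ-sound t)))
      (words n M)

    letter-allowed : ∀ y → m ≤ y → y ≤ k + 1 →
                     letter y ≡ countᵇ (accepts y y (k + rise ℓ y) τ) (words n M)
    letter-allowed y m≤y y≤k+1 = trans
      (countᵇ-cong (λ s → cong₂ (λ b c → (b ∧ c) ∧ accepts y (m ⊔ y) (k + rise ℓ y) τ s)
          (T→≡ (≤ᵇ-complete y≤k+1))
          (T→≡ (Equivalence.from (T-∨ {y ≡ᵇ 0}) (inj₂ (≤ᵇ-complete m≤y)))))
        (words n M))
      (cong (λ z → countᵇ (accepts y z (k + rise ℓ y) τ) (words n M)) (m≤n⇒m⊔n≡n m≤y))

    letter-ascent : ∀ y → ℓ < y → m ≤ y → y ≤ k + 1 →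
                    letter y ≡ countᵇ (accepts y y (k + 1) τ) (words n M)
    letter-ascent y ℓ<y m≤y y≤k+1 = trans (letter-allowed y m≤y y≤k+1)
      (cong (λ b → countᵇ (accepts y y (k + (if b then 1 else 0)) τ) (words n M)) (T→≡ (<⇒<ᵇ ℓ<y)))

    letter-repeat : ∀ y → ℓ ≡ y → m ≤ y → y ≤ k + 1 →
                    letter y ≡ countᵇ (accepts y y k τ) (words n M)
    letter-repeat y refl m≤y y≤k+1 = trans (letter-allowed y m≤y y≤k+1)
      (trans (cong (λ b → countᵇ (accepts y y (k + (if b then 1 else 0)) τ) (words n M))
               (¬T→≡ λ t → n≮n y (<ᵇ⇒< y y t)))
             (cong (λ z → countᵇ (accepts y y z τ) (words n M)) (+-identityʳ k)))

  -- The alphabet is large enough never to cut off a letter admitted by the bound on ascents.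
  enoughLetters : ∀ {m d k n M} → k ≡ suc m + d → k + 1 + suc n ≤ M →
                  ∃ λ N → M ≡ suc (m + N) × suc d < N × k + 1 + n ≤ M × k + 1 + 1 + n ≤ M
  enoughLetters {m} {d} {n = n} refl le with o , eq ← m≤n⇒∃[o]m+o≡n le =
      suc (suc d) + (n + o)
    , trans (sym eq) lemma
    , s≤s (s≤s (m≤m+n d (n + o)))
    , ≤-trans (+-monoʳ-≤ (suc m + d + 1) (n≤1+n n)) le
    , ≤-trans (≤-reflexive (+-assoc (suc m + d + 1) 1 n)) le
    where
    open ℕ.+-*-Solver
    lemma : suc m + d + 1 + suc n + o ≡ suc (m + (suc (suc d) + (n + o)))
    lemma = solve 4 (λ m d n o → con 1 :+ m :+ d :+ con 1 :+ (con 1 :+ n) :+ o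
        := con 1 :+ (m :+ (con 1 :+ (con 1 :+ d) :+ (n :+ o)))) refl m d n o

  -- The last letter is the maximum. The next one is 0, a repetition, or larger by i + 1 with i ≤ d;
  -- only the last choice is an ascent, and it leaves slack d - i.
  count-afterNonzero : ∀ n {m d k M} τ → k ≡ suc m + d → k + 1 + n ≤ M →
    countᵇ (accepts (suc m) (suc m) k τ) (words n M) ≡ afterNonzero n d (λ i j → τ (suc m + i) (k + j))
  -- After a zero, even repeating the maximum is an ascent, so a letter exceeding the maximum by i
  -- leaves slack d + 1 - i, with i ≤ d + 1.
  count-afterZero : ∀ n {m d k M} τ → k ≡ suc m + d → k + 1 + n ≤ M →
    countᵇ (accepts 0 (suc m) k τ) (words n M) ≡ afterZero n d (λ i j → τ (suc m + i) (k + j))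
  count-largerLetter : ∀ n {k M} τ y c → k + 1 ≡ suc y + c → k + 1 + 1 + n ≤ M →
    countᵇ (accepts (suc y) (suc y) (k + 1) τ) (words n M) ≡ afterNonzero n c (λ i j → τ (suc y + i) (k + suc j))

  count-largerLetter n {k} τ y c eq le = trans (count-afterNonzero n τ eq le)
    (afterNonzero-cong n c λ i j → cong (τ (suc y + i)) (+-assoc k 1 j))

  count-afterNonzero zero {m} {d} {k} τ eq le =
    trans (+-identityʳ _) (cong (if_then 1 else 0) (cong₂ τ (sym (+-identityʳ (suc m))) (sym (+-identityʳ k))))
  count-afterNonzero (suc n) {m} {d} {k} {M} τ eq le with enoughLetters {m} {d} eq le
  ... | suc N , refl , s≤s d<N , le₀ , le₁ = begin
    countᵇ (accepts (suc m) (suc m) k τ) (words (suc n) M)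
      ≡⟨ countᵇ-words (accepts (suc m) (suc m) k τ) n M ⟩
    letter 0 + sumTo (m + suc N) (letter ∘ suc)
      -- The letters 1 to `m` lie below the maximum `suc m`; dropping them leaves the repeated
      -- letter in front.
      ≡⟨ cong (letter 0 +_) (sumTo-drop m (λ i i<m → letter-small (suc i) z<s (s<s i<m))) ⟩
    letter 0 + (letter (suc (m + 0)) + sumTo N (λ i → letter (suc (m + suc i))))
      ≡⟨ +-assoc (letter 0) _ _ ⟨
    letter 0 + letter (suc (m + 0)) + sumTo N (λ i → letter (suc (m + suc i)))
      ≡⟨ cong₂ _+_ (cong₂ _+_
           (trans letter-zero (count-afterZero n τ eq le₀))
           (trans (cong letter (cong suc (+-identityʳ m)))
             (trans (letter-repeat (suc m) refl ≤-refl m<k+1) (count-afterNonzero n τ eq le₀))))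
           (sumTo-shifts d N _ (λ i j → τ (suc m + suc i) (k + suc j)) larger tooLarge d<N) ⟩
    afterNonzero (suc n) d (λ i j → τ (suc m + i) (k + j)) ∎
    where
    open ≡-Reasoning
    open Letter (suc m) (suc m) k τ n M
    m<k+1 : suc m ≤ k + 1
    m<k+1 = ≤-trans (m≤m+n (suc m) d) (≤-trans (≤-reflexive (sym eq)) (m≤m+n k 1))
    k+1≡ : k + 1 ≡ suc m + suc d
    k+1≡ = trans (cong (_+ 1) eq) (trans (+-assoc (suc m) d 1) (cong (suc m +_) (+-comm d 1)))
    larger : ∀ i c → i + c ≡ d → letter (suc (m + suc i))
           ≡ afterNonzero n c (λ a b → τ (suc m + suc (i + a)) (k + suc b))
    larger i c refl = trans
      (letter-ascent (suc (m + suc i)) (s<s (m<m+n m z<s)) (s≤s (m≤m+n m (suc i)))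
        (≤-trans (m≤m+n _ c) (≤-reflexive (sym k+1≡′))))
      (trans (count-largerLetter n τ (m + suc i) c k+1≡′ le₁)
        (afterNonzero-cong n c λ a b → cong (λ z → τ z (k + suc b)) (+-assoc (suc m) (suc i) a)))
      where
      k+1≡′ : k + 1 ≡ suc (m + suc i) + c
      k+1≡′ = trans k+1≡ (sym (+-assoc (suc m) (suc i) c))
    tooLarge : ∀ i → d < i → letter (suc (m + suc i)) ≡ 0
    tooLarge i d<i = letter-large _ (≤-<-trans (≤-reflexive k+1≡) (s<s (+-monoʳ-< m (s<s d<i))))

  count-afterZero zero {m} {d} {k} τ eq le =
    trans (+-identityʳ _) (cong (if_then 1 else 0) (cong₂ τ (sym (+-identityʳ (suc m))) (sym (+-identityʳ k))))
  count-afterZero (suc n) {m} {d} {k} {M} τ eq le with enoughLetters {m} {d} eq le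
  ... | N , refl , d<N , le₀ , le₁ = begin
    countᵇ (accepts 0 (suc m) k τ) (words (suc n) M)
      ≡⟨ countᵇ-words (accepts 0 (suc m) k τ) n M ⟩
    letter 0 + sumTo (m + N) (letter ∘ suc)
      ≡⟨ cong (letter 0 +_) (sumTo-drop m (λ i i<m → letter-small (suc i) z<s (s<s i<m))) ⟩
    letter 0 + sumTo N (λ i → letter (suc (m + i)))
      ≡⟨ cong₂ _+_ (trans letter-zero (count-afterZero n τ eq le₀))
           (sumTo-shifts (suc d) N _ (λ i j → τ (suc m + i) (k + suc j)) larger tooLarge d<N) ⟩
    afterZero (suc n) d (λ i j → τ (suc m + i) (k + j)) ∎
    where
    open ≡-Reasoning
    open Letter 0 (suc m) k τ n M
    k+1≡ : k + 1 ≡ suc m + suc d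
    k+1≡ = trans (cong (_+ 1) eq) (trans (+-assoc (suc m) d 1) (cong (suc m +_) (+-comm d 1)))
    larger : ∀ i c → i + c ≡ suc d → letter (suc (m + i))
           ≡ afterNonzero n c (λ a b → τ (suc m + (i + a)) (k + suc b))
    larger i c i+c≡ = trans
      (letter-ascent (suc (m + i)) z<s (s≤s (m≤m+n m i))
        (≤-trans (m≤m+n _ c) (≤-reflexive (sym k+1≡′))))
      (trans (count-largerLetter n τ (m + i) c k+1≡′ le₁)
        (afterNonzero-cong n c λ a b → cong (λ z → τ z (k + suc b)) (+-assoc (suc m) i a)))
      where
      k+1≡′ : k + 1 ≡ suc (m + i) + c
      k+1≡′ = trans k+1≡ (trans (cong (suc m +_) (sym i+c≡)) (sym (+-assoc (suc m) i c)))
    tooLarge : ∀ i → suc d < i → letter (suc (m + i)) ≡ 0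
    tooLarge i d<i = letter-large _ (≤-<-trans (≤-reflexive k+1≡) (s<s (+-monoʳ-< m d<i)))

  -- Without ascents the bound admits only 0 and 1, so the rest of the alphabet contributes nothing.
  count-afterZeros : ∀ n {M} τ → suc n ≤ M → countᵇ (accepts 0 0 0 τ) (words n M) ≡ afterZeros n τ
  count-afterZeros zero    τ le = +-identityʳ _
  count-afterZeros (suc n) {suc (suc M)} τ le@(s≤s (s≤s n≤M)) = begin
    countᵇ (accepts 0 0 0 τ) (words (suc n) (suc (suc M)))
      ≡⟨ countᵇ-words (accepts 0 0 0 τ) n (suc (suc M)) ⟩
    letter 0 + (letter 1 + sumTo M (λ i → letter (suc (suc i))))
      ≡⟨ cong₂ _+_ (trans letter-zero (count-afterZeros n τ (s≤s (m≤n⇒m≤1+n n≤M))))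
           (trans (cong₂ _+_ (trans (letter-ascent 1 z<s z≤n ≤-refl)
               (count-afterNonzero n {0} {0} {1} τ refl le))
               (sumTo-zero M (λ i → letter-large (suc (suc i)) (s<s z<s)))) (+-identityʳ _)) ⟩
    afterZeros (suc n) τ ∎
    where
    open ≡-Reasoning
    open Letter 0 0 0 τ n (suc (suc M))

  indicator : ℕ → ℕ → Target
  indicator a b i j = (i ≡ᵇ a) ∧ (j ≡ᵇ b)

  fCoeff-afterZeros : ∀ n a b → fCoeff (suc n) a b ≡ afterZeros n (indicator a b)
  fCoeff-afterZeros n a b = begin
    fCoeff (suc n) a b
      ≡⟨ countᵇ-words _ n (suc n) ⟩
    countᵇ (counted ∘ (0 ∷_)) (words n (suc n)) + sumTo n (λ y → countᵇ (counted ∘ (suc y ∷_)) (words n (suc n)))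
      ≡⟨ cong₂ _+_
           (countᵇ-cong (λ s → trans (cong₂ (λ p q → p ∧ q ∧ (maxL s ≡ᵇ a) ∧ (asc (0 ∷ s) ≡ᵇ b))
               (isAscentSeq-∷ 0 s) (avoids021-∷ s)) (sym (accepts-correct 0 0 0 (indicator a b) s)))
             (words n (suc n)))
           (sumTo-zero n (λ y → countᵇ-none (λ s →
             cong (_∧ (avoids021 (suc y ∷ s) ∧ (maxL (suc y ∷ s) ≡ᵇ a) ∧ (asc (suc y ∷ s) ≡ᵇ b)))
               (isAscentSeq-∷ (suc y) s))
             (words n (suc n)))) ⟩
    countᵇ (accepts 0 0 0 (indicator a b)) (words n (suc n)) + 0
      ≡⟨ +-identityʳ _ ⟩
    countᵇ (accepts 0 0 0 (indicator a b)) (words n (suc n))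
      ≡⟨ count-afterZeros n (indicator a b) ≤-refl ⟩
    afterZeros n (indicator a b) ∎
    where
    open ≡-Reasoning
    counted : List ℕ → Bool
    counted s = isAscentSeq s ∧ avoids021 s ∧ (maxL s ≡ᵇ a) ∧ (asc s ≡ᵇ b)

open import Data.Integer using (+_; -[1+_]; _+_; _*_; _-_; -_)
open ℤ.+-*-Solver using (solve; con; _:+_; _:*_; _:-_; _:=_)

-- The ring of trivariate power series

module PS₁ = PowerSeries ℤ.+-*-commutativeRing
module PS₂ = PowerSeries PS₁.powerSeriesRing
module PS₃ = PowerSeries PS₂.powerSeriesRing

infix 4 _≋_
_≋_ : Series → Series → Set
A ≋ B = ∀ n a b → A n a b ≡ B n a b

sumℤ-cong : ∀ {f g : ℕ → ℤ} → (∀ i → f i ≡ g i) → ∀ n →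
            sumℤ (map f (upTo n)) ≡ sumℤ (applyUpTo g n)
sumℤ-cong {f} {g} p n = trans (cong sumℤ (map-upTo f n)) (go f g p n)
  where
  go : ∀ f g → (∀ i → f i ≡ g i) → ∀ n → sumℤ (applyUpTo f n) ≡ sumℤ (applyUpTo g n)
  go f g p zero    = refl
  go f g p (suc n) = cong₂ _+_ (p 0) (go (f ∘ suc) (g ∘ suc) (p ∘ suc) n)

-- The triple sum is the product of power series in x over power series in v over power series in w,
-- so the ring laws come from the nested construction.
⊛-conv : ∀ A B → A ⊛ B ≋ PS₃.conv A B
⊛-conv A B n a b =
  trans (sumℤ-cong (λ i → trans (sumℤ-cong (λ j → inner i j) (suc a))
    (sym (PS₂.conv-sumℤ (λ P → P b) (λ _ _ → refl) (A i) (B (n ∸ i)) a)))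
    (suc n))
  (sym (PS₃.conv-sumℤ (λ P → P a b) (λ _ _ → refl) A B n))
  where
  inner : ∀ i j →
    sumℤ (map (λ k → A i j k * B (n ∸ i) (a ∸ j) (b ∸ k)) (upTo (suc b)))
    ≡ PS₁.conv (A i j) (B (n ∸ i) (a ∸ j)) b
  inner i j =
    trans (sumℤ-cong {λ k → A i j k * B (n ∸ i) (a ∸ j) (b ∸ k)} (λ k → refl) (suc b))
          (sym (PS₁.conv-sumℤ (λ z → z) (λ _ _ → refl) (A i j) (B (n ∸ i) (a ∸ j)) b))

⊛-cong : ∀ {A A′ B B′} → A ≋ A′ → B ≋ B′ → A ⊛ B ≋ A′ ⊛ B′
⊛-cong {A} {A′} {B} {B′} p q n a b =
  trans (⊛-conv A B n a b)
    (trans (PS₃.conv-cong p q n a b) (sym (⊛-conv A′ B′ n a b)))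

const : ℤ → Series
const c n a b = if (n ≡ᵇ 0) ∧ (a ≡ᵇ 0) ∧ (b ≡ᵇ 0) then c else + 0

const-⊛ : ∀ c A n a b → (const c ⊛ A) n a b ≡ c * A n a b
const-⊛ c A n a b =
  trans (⊛-conv (const c) A n a b)
  (trans (PS₃.conv-constˡ (const c) A (λ _ _ _ → refl) n a b)
  (trans (PS₂.conv-constˡ (const c 0) (A n) (λ _ _ → refl) a b)
         (PS₁.conv-constˡ (const c 0 0) (A n a) (λ _ → refl) b)))

⊛-identityˡ : ∀ A → 𝟙 ⊛ A ≋ A
⊛-identityˡ A n a b = trans (const-⊛ (+ 1) A n a b) (ℤ.*-identityˡ _)

⊛-comm : ∀ A B → A ⊛ B ≋ B ⊛ A
⊛-comm A B n a b =
  trans (⊛-conv A B n a b) (trans (PS₃.conv-comm A B n a b) (sym (⊛-conv B A n a b)))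

⊛-assoc : ∀ A B D → (A ⊛ B) ⊛ D ≋ A ⊛ (B ⊛ D)
⊛-assoc A B D n a b = begin
  ((A ⊛ B) ⊛ D) n a b                 ≡⟨ ⊛-conv (A ⊛ B) D n a b ⟩
  PS₃.conv (A ⊛ B) D n a b            ≡⟨ PS₃.conv-cong (⊛-conv A B) (λ _ _ _ → refl) n a b ⟩
  PS₃.conv (PS₃.conv A B) D n a b     ≡⟨ PS₃.conv-assoc A B D n a b ⟩
  PS₃.conv A (PS₃.conv B D) n a b     ≡⟨ PS₃.conv-cong {A} (λ _ _ _ → refl) (⊛-conv B D) n a b ⟨
  PS₃.conv A (B ⊛ D) n a b            ≡⟨ ⊛-conv A (B ⊛ D) n a b ⟨
  (A ⊛ (B ⊛ D)) n a b                 ∎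
  where open ≡-Reasoning

⊛-distribʳ : ∀ A B D → (B ⊕ D) ⊛ A ≋ B ⊛ A ⊕ D ⊛ A
⊛-distribʳ A B D n a b =
  trans (⊛-conv (B ⊕ D) A n a b)
  (trans (PS₃.conv-distribʳ B D A n a b)
         (sym (cong₂ _+_ (⊛-conv B A n a b) (⊛-conv D A n a b))))

seriesRing : CommutativeRing 0ℓ 0ℓ
seriesRing = record
  { Carrier = Series
  ; _≈_     = _≋_
  ; _+_     = _⊕_
  ; _*_     = _⊛_
  ; -_      = λ A n a b → - A n a b
  ; 0#      = 𝟘
  ; 1#      = 𝟙
  ; isCommutativeRing = record
    { isRing = record
      { +-isAbelianGroup = CommutativeRing.+-isAbelianGroup PS₃.powerSeriesRing
      ; *-cong     = ⊛-cong
      ; *-assoc    = ⊛-assoc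
      ; *-identity = ⊛-identityˡ , λ A n a b → trans (⊛-comm A 𝟙 n a b) (⊛-identityˡ A n a b)
      ; distrib    =
          (λ A B D n a b → trans (⊛-comm A (B ⊕ D) n a b)
            (trans (⊛-distribʳ A B D n a b) (cong₂ _+_ (⊛-comm B A n a b) (⊛-comm D A n a b))))
        , ⊛-distribʳ
      }
    ; *-comm = ⊛-comm
    }
  }

X⊛-suc : ∀ A n a b → (X ⊛ A) (suc n) a b ≡ A n a b
X⊛-suc A n a b = trans (⊛-conv X A (suc n) a b)
  (PS₃.conv-varˡ {X} A (λ _ _ → refl)
    (λ { zero zero zero → refl ; zero zero (suc _) → refl ; zero (suc _) _ → refl
       ; (suc _) _ _ → refl }) n a b)

X⊛-zero : ∀ A a b → (X ⊛ A) 0 a b ≡ + 0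
X⊛-zero A a b = trans (⊛-conv X A 0 a b) (PS₂.conv-zeroˡ (A 0) (λ _ _ → refl) a b)

V⊛-suc : ∀ A n a b → (V ⊛ A) n (suc a) b ≡ A n a b
V⊛-suc A n a b = trans (⊛-conv V A n (suc a) b)
  (trans (PS₃.conv-constˡ V A (λ _ _ _ → refl) n (suc a) b)
    (PS₂.conv-varˡ {V 0} (A n) (λ _ → refl)
      (λ { zero zero → refl ; zero (suc _) → refl ; (suc _) _ → refl }) a b))

V⊛-zero : ∀ A n b → (V ⊛ A) n 0 b ≡ + 0
V⊛-zero A n b = trans (⊛-conv V A n 0 b)
  (trans (PS₃.conv-constˡ V A (λ _ _ _ → refl) n 0 b)
    (PS₁.conv-zeroˡ (A n 0) (λ _ → refl) b))

W⊛-suc : ∀ A n a b → (W ⊛ A) n a (suc b) ≡ A n a b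
W⊛-suc A n a b = trans (⊛-conv W A n a (suc b))
  (trans (PS₃.conv-constˡ W A (λ _ _ _ → refl) n a (suc b))
  (trans (PS₂.conv-constˡ (W 0) (A n) (λ _ _ → refl) a (suc b))
    (PS₁.conv-varˡ {W 0 0} (A n a) refl (λ { zero → refl ; (suc _) → refl }) b)))

W⊛-zero : ∀ A n a → (W ⊛ A) n a 0 ≡ + 0
W⊛-zero A n a = trans (⊛-conv W A n a 0)
  (trans (PS₃.conv-constˡ W A (λ _ _ _ → refl) n a 0)
  (trans (PS₂.conv-constˡ (W 0) (A n) (λ _ _ → refl) a 0) (ℤ.*-zeroˡ (A n a 0))))

const-* : ∀ c d → const (c * d) ≋ const c ⊛ const d
const-* c d n a b = sym (trans (const-⊛ c (const d) n a b) (go ((n ≡ᵇ 0) ∧ (a ≡ᵇ 0) ∧ (b ≡ᵇ 0))))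
  where
  go : ∀ t → c * (if t then d else + 0) ≡ (if t then c * d else + 0)
  go true  = refl
  go false = ℤ.*-zeroʳ c

constHom : CommutativeRing.rawRing ℤ.+-*-commutativeRing -Raw-AlmostCommutative⟶ fromCommutativeRing seriesRing
constHom = record
  { ⟦_⟧    = const
  ; +-homo = λ c d n a b → +-if ((n ≡ᵇ 0) ∧ (a ≡ᵇ 0) ∧ (b ≡ᵇ 0)) c d
  ; *-homo = const-*
  ; -‿homo = λ c n a b → neg-if ((n ≡ᵇ 0) ∧ (a ≡ᵇ 0) ∧ (b ≡ᵇ 0)) c
  ; 0-homo = λ n a b → zero-if ((n ≡ᵇ 0) ∧ (a ≡ᵇ 0) ∧ (b ≡ᵇ 0))
  ; 1-homo = λ n a b → refl
  }
  where
  +-if : ∀ t c d → (if t then c + d else + 0) ≡ (if t then c else + 0) + (if t then d else + 0)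
  +-if true  c d = refl
  +-if false c d = refl
  neg-if : ∀ t c → (if t then - c else + 0) ≡ - (if t then c else + 0)
  neg-if true  c = refl
  neg-if false c = refl
  zero-if : ∀ t → (if t then + 0 else + 0) ≡ + 0
  zero-if true  = refl
  zero-if false = refl

private module S = CommutativeRing seriesRing

open RingIdentities seriesRing constHom using (scale-powerStep; expand-q; scale-A; scale-B; scale-S; quadratic)

-- The Narayana series

-- Pascal's rule holds here by definition, and integer values allow the differences in the minors
-- below.
binom : ℕ → ℕ → ℤ
binom n       zero    = + 1
binom zero    (suc k) = + 0
binom (suc n) (suc k) = binom n k + binom n (suc k)

-- C(n, k - 1) with value 0 at k = 0, where truncated subtraction would give C(n, 0) = 1.
binom⁻ : ℕ → ℕ → ℤ
binom⁻ n zero    = + 0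
binom⁻ n (suc k) = binom n k

binom⁻-suc : ∀ n k → binom (suc n) k ≡ binom⁻ n k + binom n k
binom⁻-suc n zero    = refl
binom⁻-suc n (suc k) = refl

binom-C : ∀ n k → + (n C k) ≡ binom n k
binom-C zero    zero    = refl
binom-C zero    (suc k) = refl
binom-C (suc n) zero    = refl
binom-C (suc n) (suc k) = begin
  + (suc n C suc k)             ≡⟨ cong +_ (nCk+nC[k+1]≡[n+1]C[k+1] n k) ⟨
  + (n C k ℕ.+ n C suc k)       ≡⟨ ℤ.pos-+ (n C k) (n C suc k) ⟩
  + (n C k) + + (n C suc k)     ≡⟨ cong₂ _+_ (binom-C n k) (binom-C n (suc k)) ⟩
  binom n k + binom n (suc k)   ∎
  where open ≡-Reasoning

binom-zero : ∀ {n k} → n < k → binom n k ≡ + 0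
binom-zero {zero}  {suc k} _         = refl
binom-zero {suc n} {suc k} (s≤s n<k) =
  cong₂ _+_ (binom-zero n<k) (binom-zero (ℕ.m<n⇒m<1+n n<k))

-- Induction on the row by Pascal's rule; the two summands need the identity at k and, through
-- `absorption⁻`, at k - 1.
absorption : ∀ n k → + suc n * binom n k ≡ + suc k * binom (suc n) (suc k)
absorption⁻ : ∀ n k → + suc n * binom⁻ n k ≡ + k * binom (suc n) k

absorption zero    zero    = refl
absorption zero    (suc k) = sym (ℤ.*-zeroʳ (+ suc (suc k)))
absorption (suc n) k       = begin
  + suc (suc n) * binom (suc n) k
    ≡⟨ cong₂ _*_ (ℤ.pos-+ 1 (suc n)) (binom⁻-suc n k) ⟩
  (+ 1 + + suc n) * (binom⁻ n k + binom n k)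
    ≡⟨ solve 3 (λ N a b → (con (+ 1) :+ N) :* (a :+ b)
         := (a :+ b) :+ (N :* a :+ N :* b)) refl
         (+ suc n) (binom⁻ n k) (binom n k) ⟩
  (binom⁻ n k + binom n k) + (+ suc n * binom⁻ n k + + suc n * binom n k)
    ≡⟨ cong₂ (λ y z → y + (z + + suc n * binom n k)) (sym (binom⁻-suc n k)) (absorption⁻ n k) ⟩
  binom (suc n) k + (+ k * binom (suc n) k + + suc n * binom n k)
    ≡⟨ cong (λ z → binom (suc n) k + (+ k * binom (suc n) k + z)) (absorption n k) ⟩
  binom (suc n) k + (+ k * binom (suc n) k + + suc k * binom (suc n) (suc k))
    ≡⟨ cong (λ z → binom (suc n) k + (+ k * binom (suc n) k + z * binom (suc n) (suc k)))
         (ℤ.pos-+ 1 k) ⟩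
  binom (suc n) k + (+ k * binom (suc n) k + (+ 1 + + k) * binom (suc n) (suc k))
    ≡⟨ solve 3 (λ K a b → a :+ (K :* a :+ (con (+ 1) :+ K) :* b)
         := (con (+ 1) :+ K) :* (a :+ b)) refl
         (+ k) (binom (suc n) k) (binom (suc n) (suc k)) ⟩
  (+ 1 + + k) * (binom (suc n) k + binom (suc n) (suc k))
    ≡⟨ cong (_* binom (suc (suc n)) (suc k)) (ℤ.pos-+ 1 k) ⟨
  + suc k * binom (suc (suc n)) (suc k) ∎
  where open ≡-Reasoning

absorption⁻ n zero    = ℤ.*-zeroʳ (+ suc n)
absorption⁻ n (suc k) = absorption n k

minor : ℕ → ℕ → ℕ → ℤ
minor n k l = binom n k * binom n l - binom⁻ n k * binom n (suc l)

-- For l = j + k the four minors are, in order, the coefficients in the four terms of `powerStep`.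
minor-pascal : ∀ n k l → minor (suc n) (suc k) (suc l)
             ≡ minor n (suc k) l + minor n (suc k) (suc l) + minor n k l + minor n k (suc l)
minor-pascal n k l rewrite binom⁻-suc n k =
  solve 6 (λ a b c x y z →
      (b :+ c) :* (x :+ y) :- (a :+ b) :* (y :+ z)
      := (c :* x :- b :* y) :+ (c :* y :- b :* z)
             :+ (b :* x :- a :* y) :+ (b :* y :- a :* z)) refl
    (binom⁻ n k) (binom n k) (binom n (suc k)) (binom n l) (binom n (suc l)) (binom n (suc (suc l)))

-- The case j = 0: the minor has proportional rows, matching the absence of positive powers of x in
-- the zeroth power.
minor-diagonal⁻ : ∀ n k → minor n (suc k) k ≡ + 0
minor-diagonal⁻ n k =
  solve 2 (λ a b → b :* a :- a :* b := con (+ 0)) refl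
    (binom n k) (binom n (suc k))

-- Multiplying the minor by n + 1 and absorbing that factor gives the product of binomials, so the
-- division in `narayana` is exact.
narayana-minor : ∀ n k → + narayana (suc n) (suc k) ≡ minor n k k
narayana-minor n k = quotient (minor n k k) refl
  where
  open ≡-Reasoning
  product : + ((suc n C suc k) ℕ.* (suc n C k)) ≡ minor n k k * + suc n
  product = begin
    + ((suc n C suc k) ℕ.* (suc n C k))
      ≡⟨ ℤ.pos-* (suc n C suc k) (suc n C k) ⟩
    + (suc n C suc k) * + (suc n C k)
      ≡⟨ cong₂ _*_ (binom-C (suc n) (suc k)) (binom-C (suc n) k) ⟩
    (b + c) * binom (suc n) k
      -- The factor 1 is written as (k + 1) - k so that absorption applies to each of the two
      -- products.
      ≡⟨ solve 4 (λ K B b c →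
           (b :+ c) :* B
           := ((con (+ 1) :+ K) :* (b :+ c)) :* B
                  :- (K :* B) :* (b :+ c)) refl
           (+ k) (binom (suc n) k) b c ⟩
    ((+ 1 + + k) * (b + c)) * binom (suc n) k - (+ k * binom (suc n) k) * (b + c)
      ≡⟨ cong₂ (λ y z → (y * (b + c)) * binom (suc n) k - z * (b + c))
           (ℤ.pos-+ 1 k) (absorption⁻ n k) ⟨
    (+ suc k * (b + c)) * binom (suc n) k - (+ suc n * a) * (b + c)
      ≡⟨ cong₂ (λ y z → y * z - (+ suc n * a) * (b + c)) (sym (absorption n k)) (binom⁻-suc n k) ⟩
    (+ suc n * b) * (a + b) - (+ suc n * a) * (b + c)
      ≡⟨ solve 4 (λ N a b c →
           (N :* b) :* (a :+ b) :- (N :* a) :* (b :+ c)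
           := (b :* b :- a :* c) :* N) refl (+ suc n) a b c ⟩
    minor n k k * + suc n ∎
    where
    a = binom⁻ n k
    b = binom n k
    c = binom n (suc k)
  -- The minor is generalised to `z` for a split on its sign; a negative value would make a natural
  -- number negative.
  quotient : ∀ z → minor n k k ≡ z → + narayana (suc n) (suc k) ≡ z
  quotient (+ q)    eq = cong +_ (trans
    (cong (ℕ._/ suc n)
      (ℤ.+-injective (trans product (trans (cong (_* + suc n) eq) (sym (ℤ.pos-* q (suc n)))))))
    (ℕ.m*n/n≡m q (suc n)))
  quotient -[1+ q ] eq with () ← trans product (cong (_* + suc n) eq)

diagonal : (ℕ → ℤ) → ℕ → ℕ → ℤ
diagonal f a b = if a ≡ᵇ b then f a else + 0

-- The coefficient of xⁿtᵏ in the j-th power of H is j/n · C(n, k) · C(n, k + j), which equals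
-- a 2 × 2 minor formed from row n − 1 of Pascal's triangle.
Hpow : ℕ → Series
Hpow zero    = 𝟙
Hpow (suc j) zero    a b = + 0
Hpow (suc j) (suc n) a b = diagonal (λ k → minor n k (j ℕ.+ k)) a b

-- The guard on the exponents in `H` cuts off only zeros, since the binomials of row n vanish beyond
-- column n.
H-Hpow : H ≋ Hpow 1
H-Hpow zero    a b rewrite ∧-zeroʳ (a ≡ᵇ b) = refl
H-Hpow (suc n) a b = trans (if-∧ (a ≡ᵇ b) (a <ᵇ suc n))
  (cong (λ z → if a ≡ᵇ b then z else + 0) (if-redundant (a <ᵇ suc n) (narayana-minor n a) vanish))
  where
  if-∧ : ∀ s t {z : ℤ} → (if s ∧ t then z else + 0) ≡ (if s then (if t then z else + 0) else + 0)
  if-∧ true  t = refl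
  if-∧ false t = refl
  if-redundant : ∀ t {y z : ℤ} → y ≡ z → (t ≡ false → z ≡ + 0) → (if t then y else + 0) ≡ z
  if-redundant true  y≡z _   = y≡z
  if-redundant false _   z≡0 = sym (z≡0 refl)
  vanish : (a <ᵇ suc n) ≡ false → minor n a a ≡ + 0
  vanish eq = trans
    (cong₂ (λ y z → y * binom n a - binom⁻ n a * z)
      (binom-zero n<a) (binom-zero (ℕ.m<n⇒m<1+n n<a)))
    (cong (λ z → + 0 - z) (ℤ.*-zeroʳ (binom⁻ n a)))
    where
    n<a : n < a
    n<a = ℕ.≰⇒> λ a≤n → subst T eq (ℕ.<⇒<ᵇ (s≤s a≤n))

VW : Series
VW = V ⊛ W

VW⊛-suc : ∀ A n a b → (VW ⊛ A) n (suc a) (suc b) ≡ A n a b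
VW⊛-suc A n a b = trans (⊛-assoc V W A n (suc a) (suc b))
  (trans (V⊛-suc (W ⊛ A) n a (suc b)) (W⊛-suc A n a b))

VW⊛-zeroˡ : ∀ A n b → (VW ⊛ A) n 0 b ≡ + 0
VW⊛-zeroˡ A n b = trans (⊛-assoc V W A n 0 b) (V⊛-zero (W ⊛ A) n b)

VW⊛-zeroʳ : ∀ A n a → (VW ⊛ A) n a 0 ≡ + 0
VW⊛-zeroʳ A n zero    = VW⊛-zeroˡ A n 0
VW⊛-zeroʳ A n (suc a) = trans (⊛-assoc V W A n (suc a) 0)
  (trans (V⊛-suc (W ⊛ A) n a 0) (W⊛-zero A n a))

-- The recurrence satisfied by the powers of any solution of h = x(1 + h)(1 + th).
powerStep : (ℕ → Series) → ℕ → Series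
powerStep P j = P j ⊕ P (suc j) ⊕ VW ⊛ P (suc j) ⊕ VW ⊛ P (suc (suc j))

PowerRecurrence : (ℕ → Series) → Set
PowerRecurrence P = ∀ j → P (suc j) ≋ X ⊛ powerStep P j

-- Agreement in a single degree of x: multiplication by v or w preserves the degree and
-- multiplication by x raises it, which drives the uniqueness proofs.
AgreeAt : ℕ → Series → Series → Set
AgreeAt n A B = ∀ a b → A n a b ≡ B n a b

VW⊛-agree : ∀ {n} A B → AgreeAt n A B → AgreeAt n (VW ⊛ A) (VW ⊛ B)
VW⊛-agree {n} A B p zero    b       = trans (VW⊛-zeroˡ A n b) (sym (VW⊛-zeroˡ B n b))
VW⊛-agree {n} A B p (suc a) zero    = trans (VW⊛-zeroʳ A n (suc a)) (sym (VW⊛-zeroʳ B n (suc a)))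
VW⊛-agree {n} A B p (suc a) (suc b) =
  trans (VW⊛-suc A n a b) (trans (p a b) (sym (VW⊛-suc B n a b)))

-- The recurrence refers forward to j + 2, so the outer induction is on the degree in x, which the
-- factor `X` lowers, for all j at once.
powerRecurrence-unique : ∀ {P Q} → PowerRecurrence P → PowerRecurrence Q →
                         P 0 ≋ Q 0 → ∀ j → P j ≋ Q j
powerRecurrence-unique {P} {Q} recP recQ base j n = go n j
  where
  go : ∀ n j → AgreeAt n (P j) (Q j)
  go n       zero    a b = base n a b
  go zero    (suc j) a b =
    trans (recP j 0 a b) (trans (X⊛-zero (powerStep P j) a b)
      (sym (trans (recQ j 0 a b) (X⊛-zero (powerStep Q j) a b))))
  go (suc n) (suc j) a b = begin
    P (suc j) (suc n) a b            ≡⟨ recP j (suc n) a b ⟩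
    (X ⊛ powerStep P j) (suc n) a b  ≡⟨ X⊛-suc (powerStep P j) n a b ⟩
    powerStep P j n a b
      ≡⟨ cong₂ _+_ (cong₂ _+_ (cong₂ _+_ (go n j a b) (go n (suc j) a b))
           (VW⊛-agree (P (suc j)) (Q (suc j)) (go n (suc j)) a b))
           (VW⊛-agree (P (suc (suc j))) (Q (suc (suc j))) (go n (suc (suc j))) a b) ⟩
    powerStep Q j n a b              ≡⟨ X⊛-suc (powerStep Q j) n a b ⟨
    (X ⊛ powerStep Q j) (suc n) a b  ≡⟨ recQ j (suc n) a b ⟨
    Q (suc j) (suc n) a b            ∎
    where open ≡-Reasoning

-- In the interior this is `minor-pascal`; the lowest degree in x, the lowest exponent of t and the
-- power j = 0 are boundary cases.
Hpow-recurrence : PowerRecurrence Hpow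
Hpow-recurrence j zero a b = sym (X⊛-zero (powerStep Hpow j) a b)
Hpow-recurrence j (suc n) a b = trans (step j n a b) (sym (X⊛-suc (powerStep Hpow j) n a b))
  where
  open ≡-Reasoning
  add-zeros : ∀ z → z ≡ z + + 0 + + 0 + + 0
  add-zeros = solve 1 (λ z → z := z :+ con (+ 0) :+ con (+ 0) :+ con (+ 0)) refl

  add-zeros² : ∀ y z → y + z ≡ y + z + + 0 + + 0
  add-zeros² = solve 2 (λ y z → y :+ z := y :+ z :+ con (+ 0) :+ con (+ 0)) refl

  if-zero : ∀ t → (if t then + 0 else + 0) ≡ + 0
  if-zero true  = refl
  if-zero false = refl

  VW⊛-diagonal : ∀ A n f → (∀ a b → A n a b ≡ diagonal f a b) →
                 ∀ a b → (VW ⊛ A) n (suc a) b ≡ (if suc a ≡ᵇ b then f a else + 0)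
  VW⊛-diagonal A n f p a zero    = VW⊛-zeroʳ A n (suc a)
  VW⊛-diagonal A n f p a (suc b) = trans (VW⊛-suc A n a b) (p a b)

  VW⊛-vanish : ∀ A n → (∀ a b → A n a b ≡ + 0) → ∀ a b → (VW ⊛ A) n a b ≡ + 0
  VW⊛-vanish A n p zero    b       = VW⊛-zeroˡ A n b
  VW⊛-vanish A n p (suc a) zero    = VW⊛-zeroʳ A n (suc a)
  VW⊛-vanish A n p (suc a) (suc b) = trans (VW⊛-suc A n a b) (p a b)

  initial : ∀ j a b → Hpow (suc j) 1 a b ≡ Hpow j 0 a b
  initial zero    zero    zero    = refl
  initial (suc j) zero    zero    = refl
  initial zero    zero    (suc b) = refl
  initial (suc j) zero    (suc b) = refl
  initial j       (suc a) b       = trans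
    (cong (λ z → if suc a ≡ᵇ b then + 0 - z else + 0) (ℤ.*-zeroʳ (binom 0 a)))
    (trans (if-zero (suc a ≡ᵇ b)) (sym (off j)))
    where
    off : ∀ j → Hpow j 0 (suc a) b ≡ + 0
    off zero    = refl
    off (suc j) = refl

  sum-if : ∀ t {p q r s : ℤ} → (if t then p + q + r + s else + 0)
    ≡ (if t then p else + 0) + (if t then q else + 0) + (if t then r else + 0) + (if t then s else + 0)
  sum-if true  = refl
  sum-if false = refl

  -- The minor formula for the j-th power involves j - 1; at j = 0 the value 0 is the coefficient of
  -- 1 in positive degree.
  previous : ℕ → ℕ → ℕ → ℤ
  previous zero    n k = + 0
  previous (suc j) n k = minor n k (j ℕ.+ k)

  Hpow-previous : ∀ j n a b → Hpow j (suc n) a b ≡ diagonal (previous j n) a b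
  Hpow-previous zero    n a b with a ≡ᵇ b
  ... | true  = refl
  ... | false = refl
  Hpow-previous (suc j) n a b = refl

  previous-suc : ∀ j n k → previous j n (suc k) ≡ minor n (suc k) (j ℕ.+ k)
  previous-suc zero    n k = sym (minor-diagonal⁻ n k)
  previous-suc (suc j) n k = cong (minor n (suc k)) (ℕ.+-suc j k)

  minor-zero : ∀ j n → minor (suc n) 0 (j ℕ.+ 0) ≡ previous j n 0 + minor n 0 (j ℕ.+ 0)
  minor-zero zero    n = refl
  minor-zero (suc j) n =
    solve 2 (λ x y → con (+ 1) :* (x :+ y) :- con (+ 0)
      := (con (+ 1) :* x :- con (+ 0)) :+ (con (+ 1) :* y :- con (+ 0)))
      refl (binom n (j ℕ.+ 0)) (binom n (suc j ℕ.+ 0))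

  minor-suc : ∀ j n k → minor (suc n) (suc k) (j ℕ.+ suc k)
    ≡ previous j n (suc k) + minor n (suc k) (j ℕ.+ suc k) + minor n k (j ℕ.+ k) + minor n k (suc j ℕ.+ k)
  minor-suc j n k rewrite previous-suc j n k | ℕ.+-suc j k = minor-pascal n k (j ℕ.+ k)

  step : ∀ j n a b → Hpow (suc j) (suc n) a b ≡ powerStep Hpow j n a b
  step j zero a b = begin
    Hpow (suc j) 1 a b              ≡⟨ initial j a b ⟩
    Hpow j 0 a b                    ≡⟨ add-zeros (Hpow j 0 a b) ⟩
    Hpow j 0 a b + + 0 + + 0 + + 0  ≡⟨ cong₂ (λ y z → Hpow j 0 a b + + 0 + y + z)
                                         (VW⊛-vanish (Hpow (suc j)) 0 (λ _ _ → refl) a b)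
                                         (VW⊛-vanish (Hpow (suc (suc j))) 0 (λ _ _ → refl) a b) ⟨
    powerStep Hpow j 0 a b          ∎
  step j (suc n) zero b = begin
    diagonal (λ k → minor (suc n) k (j ℕ.+ k)) 0 b
      ≡⟨ cong (λ z → if 0 ≡ᵇ b then z else + 0) (trans (minor-zero j n) (add-zeros² (previous j n 0) (minor n 0 (j ℕ.+ 0)))) ⟩
    (if 0 ≡ᵇ b then previous j n 0 + minor n 0 (j ℕ.+ 0) + + 0 + + 0 else + 0)
      ≡⟨ sum-if (0 ≡ᵇ b) ⟩
    _ ≡⟨ cong₂ _+_ (cong₂ _+_ (cong (_+ Hpow (suc j) (suc n) 0 b) (sym (Hpow-previous j n 0 b)))
          (trans (if-zero (0 ≡ᵇ b)) (sym (VW⊛-zeroˡ (Hpow (suc j)) (suc n) b))))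
          (trans (if-zero (0 ≡ᵇ b)) (sym (VW⊛-zeroˡ (Hpow (suc (suc j))) (suc n) b))) ⟩
    powerStep Hpow j (suc n) 0 b ∎
  step j (suc n) (suc a) b = begin
    diagonal (λ k → minor (suc n) k (j ℕ.+ k)) (suc a) b
      ≡⟨ cong (λ z → if suc a ≡ᵇ b then z else + 0) (minor-suc j n a) ⟩
    (if suc a ≡ᵇ b then previous j n (suc a) + minor n (suc a) (j ℕ.+ suc a) + minor n a (j ℕ.+ a) + minor n a (suc j ℕ.+ a) else + 0)
      ≡⟨ sum-if (suc a ≡ᵇ b) ⟩
    _ ≡⟨ cong₂ _+_ (cong₂ _+_ (cong (_+ Hpow (suc j) (suc n) (suc a) b) (sym (Hpow-previous j n (suc a) b)))
          (sym (VW⊛-diagonal (Hpow (suc j)) (suc n) _ (λ _ _ → refl) a b)))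
          (sym (VW⊛-diagonal (Hpow (suc (suc j))) (suc n) _ (λ _ _ → refl) a b)) ⟩
    powerStep Hpow j (suc n) (suc a) b ∎

-- Both j ↦ Hpow (j + 1) and j ↦ H · Hpow j satisfy the recurrence with the same initial term.
Hpow-suc : ∀ j → Hpow (suc j) ≋ Hpow 1 ⊛ Hpow j
Hpow-suc = powerRecurrence-unique {λ j → Hpow (suc j)} {λ j → Hpow 1 ⊛ Hpow j}
  (λ j → Hpow-recurrence (suc j))
  (λ j → S.trans {Hpow 1 ⊛ Hpow (suc j)}
    (S.*-congˡ {Hpow 1} (Hpow-recurrence j))
    (scale-powerStep X VW (Hpow 1) (Hpow j) (Hpow (suc j)) (Hpow (suc (suc j)))))
  (S.sym {Hpow 1 ⊛ 𝟙} (S.*-identityʳ (Hpow 1)))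

qOf : Series → Series
qOf A = 𝟙 ⊕ VW ⊛ A ⊛ (𝟙 ⊕ A)

q : Series
q = qOf H

-- The recurrence at j = 0, with the second power recognised as a square, reads h = x(1 + h + th +
-- th²).
H-equation : H ≋ X ⊛ (q ⊕ H)
H-equation = begin
  H                                     ≈⟨ H-Hpow ⟩
  Hpow 1                                ≈⟨ Hpow-recurrence 0 ⟩
  X ⊛ powerStep Hpow 0                  ≈⟨ S.*-congˡ {X} (S.+-congˡ {𝟙 ⊕ Hpow 1 ⊕ VW ⊛ Hpow 1}
                                             (S.*-congˡ {VW} (Hpow-suc 1))) ⟩
  X ⊛ (𝟙 ⊕ Hpow 1 ⊕ VW ⊛ Hpow 1 ⊕ VW ⊛ (Hpow 1 ⊛ Hpow 1))
                                        ≈⟨ expand-q X VW (Hpow 1) ⟩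
  X ⊛ (qOf (Hpow 1) ⊕ Hpow 1)           ≈⟨ S.*-congˡ {X} (S.+-cong {qOf (Hpow 1)} (S.+-congˡ {𝟙}
                                             (S.*-cong {VW ⊛ Hpow 1} (S.*-congˡ {VW} Hpow-H)
                                               (S.+-congˡ {𝟙} Hpow-H))) Hpow-H) ⟩
  X ⊛ (q ⊕ H)                           ∎
  where
  open import Relation.Binary.Reasoning.Setoid S.setoid
  Hpow-H : Hpow 1 ≋ H
  Hpow-H n a b = sym (H-Hpow n a b)

-- The slack system

-- Generating functions, by number of further letters, of the continuations of a prefix
-- whose last letter is nonzero (A), respectively zero (B); d is the excess of the number
-- of ascents over the maximum, and c is the contribution of the empty continuation.
record SlackSystem (c : Series) (A B S : ℕ → Series) : Set where
  field
    A-rec  : ∀ d → A d ≋ c ⊕ X ⊛ (B d ⊕ A d ⊕ W ⊛ V ⊛ S d)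
    B-rec  : ∀ d → B d ≋ c ⊕ X ⊛ (B d ⊕ W ⊛ S (suc d))
    S-zero : S 0 ≋ A 0
    S-suc  : ∀ d → S (suc d) ≋ A (suc d) ⊕ V ⊛ S d

V⊛-agree : ∀ {n} A B → AgreeAt n A B → AgreeAt n (V ⊛ A) (V ⊛ B)
V⊛-agree {n} A B p zero    b = trans (V⊛-zero A n b) (sym (V⊛-zero B n b))
V⊛-agree {n} A B p (suc a) b = trans (V⊛-suc A n a b) (trans (p a b) (sym (V⊛-suc B n a b)))

W⊛-agree : ∀ {n} A B → AgreeAt n A B → AgreeAt n (W ⊛ A) (W ⊛ B)
W⊛-agree {n} A B p a zero    = trans (W⊛-zero A n a) (sym (W⊛-zero B n a))
W⊛-agree {n} A B p a (suc b) = trans (W⊛-suc A n a b) (trans (p a b) (sym (W⊛-suc B n a b)))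

X⊛-agree : ∀ {n} A B → AgreeAt n A B → AgreeAt (suc n) (X ⊛ A) (X ⊛ B)
X⊛-agree {n} A B p a b = trans (X⊛-suc A n a b) (trans (p a b) (sym (X⊛-suc B n a b)))

module _ {c : Series} {A B S A′ B′ S′ : ℕ → Series}
         (sys : SlackSystem c A B S) (sys′ : SlackSystem c A′ B′ S′) where
  private
    module L = SlackSystem sys
    module R = SlackSystem sys′

    transfer : ∀ {n P P′ Q Q′} → P ≋ Q → P′ ≋ Q′ → AgreeAt n Q Q′ → AgreeAt n P P′
    transfer {n} p p′ q a b = trans (p n a b) (trans (q a b) (sym (p′ n a b)))

    -- `S d` is the sum of vⁱ `A (d − i)` over i ≤ d, so in each degree of x it is determined by
    -- `A`; the induction on d keeps that degree fixed.
    S-agree : ∀ n → (∀ d → AgreeAt n (A d) (A′ d)) → ∀ d → AgreeAt n (S d) (S′ d)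
    S-agree n p zero    = transfer L.S-zero R.S-zero (p 0)
    S-agree n p (suc d) = transfer (L.S-suc d) (R.S-suc d) λ a b →
      cong₂ _+_ (p (suc d) a b) (V⊛-agree (S d) (S′ d) (S-agree n p d) a b)

    -- The equation for `B d` refers to slack d + 1, so the induction is on the degree in x with all
    -- slacks treated together.
    AB-agree : ∀ n d → AgreeAt n (A d) (A′ d) × AgreeAt n (B d) (B′ d)
    AB-agree zero d =
        transfer (L.A-rec d) (R.A-rec d) (λ a b → cong (λ z → c 0 a b + z)
          (trans (X⊛-zero (B d ⊕ A d ⊕ W ⊛ V ⊛ S d) a b)
            (sym (X⊛-zero (B′ d ⊕ A′ d ⊕ W ⊛ V ⊛ S′ d) a b))))
      , transfer (L.B-rec d) (R.B-rec d) (λ a b → cong (λ z → c 0 a b + z)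
          (trans (X⊛-zero (B d ⊕ W ⊛ S (suc d)) a b)
            (sym (X⊛-zero (B′ d ⊕ W ⊛ S′ (suc d)) a b))))
    AB-agree (suc n) d =
        transfer (L.A-rec d) (R.A-rec d) (λ a b → cong (λ z → c (suc n) a b + z)
          (X⊛-agree (B d ⊕ A d ⊕ W ⊛ V ⊛ S d) (B′ d ⊕ A′ d ⊕ W ⊛ V ⊛ S′ d)
            (λ a b → cong₂ _+_ (cong₂ _+_ (proj₂ (AB-agree n d) a b) (proj₁ (AB-agree n d) a b))
              (transfer (⊛-assoc W V (S d)) (⊛-assoc W V (S′ d))
                (W⊛-agree (V ⊛ S d) (V ⊛ S′ d) (V⊛-agree (S d) (S′ d) (S-eq d))) a b))
            a b))
      , transfer (L.B-rec d) (R.B-rec d) (λ a b → cong (λ z → c (suc n) a b + z)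
          (X⊛-agree (B d ⊕ W ⊛ S (suc d)) (B′ d ⊕ W ⊛ S′ (suc d))
            (λ a b → cong₂ _+_ (proj₂ (AB-agree n d) a b)
              (W⊛-agree (S (suc d)) (S′ (suc d)) (S-eq (suc d)) a b))
            a b))
      where
      S-eq = S-agree n (λ d → proj₁ (AB-agree n d))

  slackSystem-unique : ∀ d → A d ≋ A′ d
  slackSystem-unique d n = proj₁ (AB-agree n d)

-- The explicit solution carries the factor `k`. Scaling the counting system to the same constant
-- term allows a comparison without inverting `k`.
slackSystem-scale : ∀ k {A B S} → SlackSystem 𝟙 A B S →
  SlackSystem k (λ d → k ⊛ A d) (λ d → k ⊛ B d) (λ d → k ⊛ S d)
slackSystem-scale k {A} {B} {S} sys = record
  { A-rec  = λ d → S.trans {k ⊛ A d} (S.*-congˡ {k} (A-rec d))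
      (S.trans {k ⊛ (𝟙 ⊕ X ⊛ (B d ⊕ A d ⊕ W ⊛ V ⊛ S d))} (scale-A k 𝟙 X (W ⊛ V) (A d) (B d) (S d))
        (S.+-congʳ {X ⊛ (k ⊛ B d ⊕ k ⊛ A d ⊕ W ⊛ V ⊛ (k ⊛ S d))} (S.*-identityʳ k)))
  ; B-rec  = λ d → S.trans {k ⊛ B d} (S.*-congˡ {k} (B-rec d))
      (S.trans {k ⊛ (𝟙 ⊕ X ⊛ (B d ⊕ W ⊛ S (suc d)))} (scale-B k 𝟙 X W (B d) (S (suc d)))
        (S.+-congʳ {X ⊛ (k ⊛ B d ⊕ W ⊛ (k ⊛ S (suc d)))} (S.*-identityʳ k)))
  ; S-zero = S.*-congˡ {k} S-zero
  ; S-suc  = λ d → S.trans {k ⊛ S (suc d)} (S.*-congˡ {k} (S-suc d))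
      (scale-S k V (A (suc d)) (S d))
  }
  where open SlackSystem sys

-- The relation for `q` holds by computation, `const (+ 1)` and `𝟙` having the same coefficients.
private module K = RingIdentities.Kernel seriesRing constHom X V W H q H-equation (λ _ _ _ → refl)

-- Powers of the characteristic root v q, multiplied on the left to match the argument `v * q * r`
-- in the solution lemmas.
rootPower : ℕ → Series
rootPower zero    = 𝟙
rootPower (suc d) = V ⊛ q ⊛ rootPower d

explicitSolution : SlackSystem K.k
  (λ d → K.solutionA (rootPower d)) (λ d → K.solutionB (rootPower d)) (λ d → K.solutionS (rootPower d))
explicitSolution = record
  { A-rec  = λ d → K.solution-A (rootPower d)
  ; B-rec  = λ d → K.solution-B (rootPower d)
  ; S-zero = K.solution-S-zero
  ; S-suc  = λ d → K.solution-S-suc (rootPower d)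
  }

-- Generating functions of the continuation counts

open Automaton

seriesOf : (ℕ → Target → ℕ) → Series
seriesOf f n a b = + f n (indicator a b)

Null : (ℕ → Target → ℕ) → Set
Null f = ∀ n {τ} → (∀ i j → τ i j ≡ false) → f n τ ≡ 0

-- Shifting the target lowers the exponent of v sought by one, which is multiplication by v; at
-- exponent 0 the shifted indicator is never met.
seriesOf-V : ∀ f → Null f → seriesOf (λ n τ → f n (λ i j → τ (suc i) j)) ≋ V ⊛ seriesOf f
seriesOf-V f f-null n zero    b = trans (cong +_ (f-null n λ _ _ → refl)) (sym (V⊛-zero (seriesOf f) n b))
seriesOf-V f f-null n (suc a) b = sym (V⊛-suc (seriesOf f) n a b)

seriesOf-W : ∀ f → Null f → seriesOf (λ n τ → f n (λ i j → τ i (suc j))) ≋ W ⊛ seriesOf f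
seriesOf-W f f-null n a zero    = trans (cong +_ (f-null n λ _ _ → ∧-zeroʳ _)) (sym (W⊛-zero (seriesOf f) n a))
seriesOf-W f f-null n a (suc b) = sym (W⊛-suc (seriesOf f) n a b)

seriesOf-WV : ∀ f → Null f → seriesOf (λ n τ → f n (λ i j → τ (suc i) (suc j))) ≋ W ⊛ V ⊛ seriesOf f
seriesOf-WV f f-null n a b = begin
  seriesOf (λ n τ → f n (λ i j → τ (suc i) (suc j))) n a b
    ≡⟨ seriesOf-W (λ n τ → f n (λ i j → τ (suc i) j)) (λ n p → f-null n (λ i → p (suc i))) n a b ⟩
  (W ⊛ seriesOf (λ n τ → f n (λ i j → τ (suc i) j))) n a b
    ≡⟨ S.*-congˡ {W} (seriesOf-V f f-null) n a b ⟩
  (W ⊛ (V ⊛ seriesOf f)) n a b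
    ≡⟨ ⊛-assoc W V (seriesOf f) n a b ⟨
  (W ⊛ V ⊛ seriesOf f) n a b ∎
  where open ≡-Reasoning

fromRecurrence : ∀ {Q P} → (∀ a b → Q 0 a b ≡ 𝟙 0 a b) → (∀ n a b → Q (suc n) a b ≡ P n a b) →
                 Q ≋ 𝟙 ⊕ X ⊛ P
fromRecurrence {P = P} p q zero    a b = trans (p a b)
  (trans (sym (ℤ.+-identityʳ _)) (cong (λ z → 𝟙 0 a b + z) (sym (X⊛-zero P a b))))
fromRecurrence {P = P} p q (suc n) a b =
  trans (q n a b) (trans (sym (X⊛-suc P n a b)) (sym (ℤ.+-identityˡ _)))

indicator-origin : ∀ a b → + (if indicator a b 0 0 then 1 else 0) ≡ 𝟙 0 a b
indicator-origin zero    zero    = refl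
indicator-origin zero    (suc b) = refl
indicator-origin (suc a) b       = refl

nonzeroGF zeroGF shiftsGF : ℕ → Series
nonzeroGF d = seriesOf (λ n → afterNonzero n d)
zeroGF d = seriesOf (λ n → afterZero n d)
shiftsGF d = seriesOf (λ n → shifts (afterNonzero n) d)

zerosGF : Series
zerosGF = seriesOf afterZeros

shiftsGF-null : ∀ d → Null (λ n → shifts (afterNonzero n) d)
shiftsGF-null d n = shifts-none (afterNonzero-none n) d

countingSystem : SlackSystem 𝟙 nonzeroGF zeroGF shiftsGF
countingSystem = record
  { A-rec  = λ d → fromRecurrence indicator-origin λ n a b →
      trans (ℤ.pos-+ (afterZero n d (indicator a b) ℕ.+ afterNonzero n d (indicator a b)) _)
        (cong₂ _+_ (ℤ.pos-+ (afterZero n d (indicator a b)) _)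
          (seriesOf-WV (λ n → shifts (afterNonzero n) d) (shiftsGF-null d) n a b))
  ; B-rec  = λ d → fromRecurrence indicator-origin λ n a b →
      trans (ℤ.pos-+ (afterZero n d (indicator a b)) _)
        (cong (λ z → zeroGF d n a b + z)
          (seriesOf-W (λ n → shifts (afterNonzero n) (suc d)) (shiftsGF-null (suc d)) n a b))
  ; S-zero = λ _ _ _ → refl
  ; S-suc  = λ d n a b → trans (ℤ.pos-+ (afterNonzero n (suc d) (indicator a b)) _)
      (cong (λ z → nonzeroGF (suc d) n a b + z)
        (seriesOf-V (λ n → shifts (afterNonzero n) d) (shiftsGF-null d) n a b))
  }

zerosGF-rec : zerosGF ≋ 𝟙 ⊕ X ⊛ (zerosGF ⊕ W ⊛ V ⊛ nonzeroGF 0)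
zerosGF-rec = fromRecurrence indicator-origin λ n a b →
  trans (ℤ.pos-+ (afterZeros n (indicator a b)) _)
    (cong (λ z → zerosGF n a b + z) (seriesOf-WV (λ n → afterNonzero n 0) (λ n → afterNonzero-none n 0) n a b))

-- The factor x accounts for the obligatory initial 0, an all-zero prefix.
F-zerosGF : F ≋ X ⊛ zerosGF
F-zerosGF zero    a b = sym (X⊛-zero zerosGF a b)
F-zerosGF (suc n) a b = trans (cong +_ (fCoeff-afterZeros n a b)) (sym (X⊛-suc zerosGF n a b))

theorem2 : (∀ n a b →
    (F ⊛ ((𝟙 ⊖ X) ⊛ (((𝟙 ⊖ V) ⊛ ((𝟙 ⊖ X) ⊛ (𝟙 ⊖ X) ⊖ W ⊛ X ⊛ X)) ⊖ V ⊛ W ⊛ X))) n a b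
    ≡ (X ⊛ (𝟙 ⊖ V) ⊛ ((𝟙 ⊖ X) ⊛ (𝟙 ⊖ X) ⊖ W ⊛ X ⊛ X)
    ⊖ V ⊛ V ⊛ W ⊛ X ⊛ (𝟙 ⊖ X) ⊛ H) n a b)
    × (∀ n a b →
    (X ⊛ (V ⊛ W) ⊛ H ⊛ H ⊖ (𝟙 ⊖ X ⊖ X ⊛ (V ⊛ W)) ⊛ H ⊕ X) n a b ≡ 𝟘 n a b)
theorem2 =
    -- Uniqueness at slack 0 evaluates k times `nonzeroGF 0`, the root entering with exponent 0.
    -- Subtraction in the ring agrees with `⊖` by computation.
    K.kernelEquation {nonzeroGF 0} {zerosGF} {F}
      (slackSystem-unique (slackSystem-scale K.k countingSystem) explicitSolution 0)
      zerosGF-rec F-zerosGF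
  , quadratic {X} {VW} {H} H-equation
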